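{- Let $p$ be a prime with $p\ne 3$, let $q=p^k$ where $k$ is a positive integer, and let $Q,R,S\in\{p^i : i\ge 0\}$. Let $\omega\in\mathbb{F}_{q^2}^*$ be an element of multiplicative order $3$, and let $r$ be a positive integer such that $r\equiv Q+R+S\pmod{q+1}$. Define \begin{align*} C_1(X) := {} & (\omega^{Q+R+S}-\omega) X^{Q+R+S} + (\omega^{Q+R}-\omega^{S+1}) X^{Q+R} \\ & + (\omega^{Q+S}-\omega^{R+1}) X^{Q+S} + (\omega^{R+S}-\omega^{Q+1}) X^{R+S} \\ & + (\omega^Q-\omega^{R+S+1}) X^Q + (\omega^R-\omega^{Q+S+1}) X^R \\ & + (\omega^S-\omega^{Q+R+1}) X^S + (1-\omega^{Q+R+S+1}) \end{align*} and $C_2(X) := X^{Q+R+S} C_1(1/X)$. Let $\beta=\omega^{Q+R}-\omega^{S+1}$ if $Q+R+S\equiv 1\pmod 3$, and $\beta=\omega^{Q+R+S}-\omega$ otherwise, and write $B_z(X) := C_z(X)/\beta$ for each $z\in\{1,2\}$. Then for each $z\in\{1,2\}$: (i) $B_z(X)$ has at most five terms, its coefficients are in $\mathbb{F}_p$, and if the integers $Q,R,S$ are pairwise distinct then the coefficients of (the terms of) $B_z(X)$ are in $\{1,-1\}$. (ii) Let $e$ be the unique integer in $\{1,-1\}$ with $q\equiv e\pmod 3$. Then $f(X) := X^r B_z(X^{q-1})$ permutes $\mathbb{F}_{q^2}$ if and only if $\gcd(r,q-1)=1$ and $\gcd(Q+R+S,q+e)=1$.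
   Context: A polynomial $f(X)\in\mathbb{F}_{q^2}[X]$ permutes $\mathbb{F}_{q^2}$ if the function $\alpha\mapsto f(\alpha)$ is a bijection $\mathbb{F}_{q^2}\to\mathbb{F}_{q^2}$. The "terms" of a polynomial are its monomials with nonzero coefficient, and the assertion that the coefficients lie in $\{1,-1\}$ refers to these nonzero coefficients (as elements of $\mathbb{F}_p$). -}

module Defs where

open import Algebra.Apartness.Bundles using (HeytingField; HeytingCommutativeRing)
open import Algebra.Bundles using (CommutativeRing)
open import Data.Bool.Base using (if_then_else_)
open import Data.Fin.Base using (Fin)
open import Data.Fin.Patterns using (0F; 1F)
open import Data.List.Base using (List; []; _∷_; length; map)
open import Data.List.Membership.Propositional using (_∈_)
open import Data.Nat.Base as ℕ using (ℕ; _∸_)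
open import Data.Nat.DivMod using (_%_)
open import Data.Nat.Properties using (_≟_)
open import Data.Product.Base using (_×_; _,_; ∃; proj₁; map₁; map₂)
open import Data.Sum.Base using (_⊎_)
open import Function.Bundles using (Bijection)
open import Function.Definitions using (Bijective)
open import Relation.Binary.PropositionalEquality.Core using (_≡_)
open import Relation.Binary.PropositionalEquality.Properties as ≡ using ()
open import Relation.Nullary.Decidable.Core using (does)
open import Relation.Nullary.Negation.Core using (¬_)

IsPowerOf : ℕ → ℕ → Set
IsPowerOf p n = ∃ λ i → n ≡ p ℕ.^ i

-- For a field of finite cardinality, _≈_ is decidable and _#_ coincides with
-- the negation of _≈_, so a finite Heyting field is the same thing as a
-- finite field.
module OverField {c ℓ₁ ℓ₂} (F : HeytingField c ℓ₁ ℓ₂) where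

  open HeytingField F
  open CommutativeRing (HeytingCommutativeRing.commutativeRing heytingCommutativeRing)
    using (semiring)
  open import Algebra.Properties.Semiring.Exp semiring using (_^_)
  open import Algebra.Properties.Semiring.Mult semiring
    using () renaming (_×_ to _·_)

  HasCardinality : ℕ → Set _
  HasCardinality n = Bijection (≡.setoid (Fin n)) setoid

  HasOrder : Carrier → ℕ → Set _
  HasOrder x n =
    0 ℕ.< n × x ^ n ≈ 1# × (∀ m → 0 ℕ.< m → x ^ m ≈ 1# → n ℕ.≤ m)

  -- The prime subfield 𝔽ₚ, when F has characteristic p > 0.
  InPrimeField : Carrier → Set _
  InPrimeField x = ∃ λ n → x ≈ n · 1#

  Nonzero : Carrier → Set _
  Nonzero x = x # 0#

  -- The library provides the inverse of x - 0#, which is the inverse of x.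
  inv : ∀ {x} → Nonzero x → Carrier
  inv x≠0 = proj₁ (#⇒invertible x≠0)

  -- A polynomial is a formal sum of monomials a Xᵐ, represented by pairs
  -- (a , m).  Exponents may repeat and coefficients may vanish, so the actual
  -- coefficient of Xⁱ is the sum of all the a that occur with m = i.
  Poly : Set c
  Poly = List (Carrier × ℕ)

  coeff : Poly → ℕ → Carrier
  coeff []            i = 0#
  coeff ((a , m) ∷ f) i = (if does (m ≟ i) then a else 0#) + coeff f i

  eval : Poly → Carrier → Carrier
  eval []            x = 0#
  eval ((a , m) ∷ f) x = a * x ^ m + eval f x

  -- a f(X)
  scale : Carrier → Poly → Poly
  scale a = map (map₁ (a *_))

  -- Xⁿ f(X)
  shift : ℕ → Poly → Poly
  shift n = map (map₂ (n ℕ.+_))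

  -- f(Xⁿ)
  expand : ℕ → Poly → Poly
  expand n = map (map₂ (n ℕ.*_))

  -- Xⁿ f(1/X), provided that every exponent listed in f is at most n (the
  -- subtraction is truncated).
  reciprocal : ℕ → Poly → Poly
  reciprocal n = map (map₂ (n ∸_))

  IsTerm : Poly → ℕ → Set _
  IsTerm f i = ¬ (coeff f i ≈ 0#)

  AtMostTerms : ℕ → Poly → Set _
  AtMostTerms n f = ∃ λ is → length is ℕ.≤ n × (∀ i → IsTerm f i → i ∈ is)

  CoeffsInPrimeField : Poly → Set _
  CoeffsInPrimeField f = ∀ i → InPrimeField (coeff f i)

  TermsHaveCoeff±1 : Poly → Set _
  TermsHaveCoeff±1 f = ∀ i → IsTerm f i → coeff f i ≈ 1# ⊎ coeff f i ≈ - 1#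

  Permutes : Poly → Set _
  Permutes f = Bijective _≈_ _≈_ (eval f)

  module _ (ω : Carrier) (Q R S : ℕ) where

    C₁ : Poly
    C₁ = (ω ^ (Q ℕ.+ R ℕ.+ S) - ω                  , Q ℕ.+ R ℕ.+ S)
       ∷ (ω ^ (Q ℕ.+ R) - ω ^ (S ℕ.+ 1)            , Q ℕ.+ R)
       ∷ (ω ^ (Q ℕ.+ S) - ω ^ (R ℕ.+ 1)            , Q ℕ.+ S)
       ∷ (ω ^ (R ℕ.+ S) - ω ^ (Q ℕ.+ 1)            , R ℕ.+ S)
       ∷ (ω ^ Q - ω ^ (R ℕ.+ S ℕ.+ 1)              , Q)
       ∷ (ω ^ R - ω ^ (Q ℕ.+ S ℕ.+ 1)              , R)
       ∷ (ω ^ S - ω ^ (Q ℕ.+ R ℕ.+ 1)              , S)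
       ∷ (1# - ω ^ (Q ℕ.+ R ℕ.+ S ℕ.+ 1)           , 0)
       ∷ []

    C₂ : Poly
    C₂ = reciprocal (Q ℕ.+ R ℕ.+ S) C₁

    C : Fin 2 → Poly
    C 0F = C₁
    C 1F = C₂

    β : Carrier
    β = if does ((Q ℕ.+ R ℕ.+ S) % 3 ≟ 1)
        then ω ^ (Q ℕ.+ R) - ω ^ (S ℕ.+ 1)
        else ω ^ (Q ℕ.+ R ℕ.+ S) - ω

    B : Nonzero β → Fin 2 → Poly
    B β≠0 z = scale (inv β≠0) (C z)

module Submission where

-- Let n = Q + R + S, a = x + ω and b = ω x + 1.  As Q, R and S are powers of the
-- characteristic, C₁ = bⁿ - ω aⁿ and C₂ = aⁿ - ω bⁿ, so that C₂ / C₁ = ν⁻¹ ∘ xⁿ ∘ ν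
-- with ν = a / b.  On the group μ of (q + 1)-th roots of unity, xⁿ C₁(x)^q is a
-- constant multiple of C₂(x); hence the (q - 1)-th power of u^r C₁(u^(q-1)) is a
-- constant multiple of the value of C₂ / C₁ at u^(q-1).  It follows that f permutes
-- the field iff gcd(r, q - 1) = 1 and C₂ / C₁ permutes μ.  Now ν maps μ onto μ if
-- q ≡ 1 (mod 3) and onto the projective line over the field of q elements if
-- q ≡ -1 (mod 3), where xⁿ is bijective iff n is coprime to q + 1, respectively q - 1.
--
-- The coefficients of C₁ have the form ω^u - ω^v with u + v = n + 1.  There is only
-- one unordered pair of distinct residues modulo 3 with a given sum, so they are 0
-- or ± β.

open import Defs
open import Algebra.Apartness.Bundles using (HeytingField; HeytingCommutativeRing)
open import Algebra.Bundles using (CommutativeMonoid; CommutativeRing)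
open import Algebra.Solver.Ring.AlmostCommutativeRing using (fromCommutativeRing; _-Raw-AlmostCommutative⟶_)
open import Data.Bool.Base using (Bool; true; false; not; if_then_else_)
open import Data.Fin.Base as Fin using (Fin; zero; suc; toℕ; fromℕ; punchIn)
open import Data.Fin.Patterns using (0F; 1F)
open import Data.Fin.Permutation using (Permutation; permutation)
open import Data.Fin.Properties as Fin using (toℕ-inject₁; toℕ-fromℕ; toℕ<n)
open import Data.Integer.Base as ℤ using (ℤ; -[1+_]; _⊖_; 0ℤ; 1ℤ; -1ℤ; +_)
open import Data.Integer.Divisibility as ℤ using ()
open import Data.Integer.GCD as ℤ using ()
open import Data.Integer.Properties as ℤ using ()
open import Data.List.Base as List using (List; []; _∷_; map; length; filterᵇ)
open import Data.List.Membership.Propositional using (_∈_)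
open import Data.List.Properties using (length-replicate)
open import Data.List.Relation.Binary.Pointwise.Base using (Pointwise; []; _∷_)
open import Data.List.Relation.Unary.All using (All; []; _∷_)
open import Data.List.Relation.Unary.AllPairs using ([]; _∷_)
open import Data.List.Relation.Unary.Any using (here; there)
open import Data.List.Relation.Unary.Unique.Propositional using (Unique)
open import Data.Maybe.Base as Maybe using (Maybe)
open import Data.Nat.Base as ℕ using (ℕ; zero; suc; z≤n; s≤s; s<s; _∸_)
open import Data.Nat.Combinatorics using (_C_; nCn≡1; nCk+nC[k+1]≡[n+1]C[k+1]; k>n⇒nCk≡0)
open import Data.Nat.Divisibility using (_∣_; divides; ∣⇒≤; m∣m*n; n∣m*n; ∣-trans; ∣m+n∣m⇒∣n; ∣1⇒≡1; m%n≡0⇒n∣m)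
open import Data.Nat.DivMod using (_%_; _/_; m≡m%n+[m/n]*n; m%n<n; %-distribˡ-+; %-distribˡ-*)
open import Data.Nat.GCD using (gcd; gcd-GCD; gcd[m,n]∣m; gcd[m,n]∣n; gcd[m,n]≡0⇒m≡0; module Bézout)
open import Data.Nat.Primality using (Prime; euclidsLemma; prime⇒nonTrivial; prime⇒nonZero; prime⇒irreducible; ¬prime[0]; ¬prime[1])
open import Data.Nat.Properties as ℕ using (allUpTo?)
open import Data.Nat.Tactic.RingSolver using (solve-∀)
open import Data.Product.Base using (Σ; _×_; _,_; ∃; proj₁; proj₂; map₂)
open import Data.Sum.Base as Sum using (_⊎_; inj₁; inj₂)
open import Data.Unit.Base using (tt)
open import Data.Vec.Functional as Vec using (init; tail)
open import Function.Base using (_∘_)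
open import Function.Bundles using (Bijection; Equivalence; _⇔_; mk⇔)
open import Function.Definitions using (Congruent; Injective)
open import Level using (_⊔_)
open import Relation.Binary.Bundles using (Setoid)
open import Relation.Binary.Definitions using (Decidable; tri<; tri≈; tri>)
open import Relation.Binary.PropositionalEquality as ≡ using (_≡_; _≢_)
open import Relation.Nullary.Decidable using (Dec; yes; no; does; map′; ¬?; decidable-stable; dec⇒maybe; dec-true; dec-false; toWitness; _→-dec_; _×-dec_; _⊎-dec_)
open import Relation.Nullary.Negation.Core using (¬_; contradiction)

-- When q ≡ -1 (mod 3) the quotient a / b has a zero and a pole on μ, so no quotient is ever formed:
-- values are compared by cross-multiplication, and pairs of points for which a product vanishes are
-- treated apart. One argument then serves both residues of q, with l = q + 1 or l = q - 1.
-- Necessity of gcd(n, l) = 1 is tested at one point. As ν fixes 1, a root of unity ζ ≠ 1 with ζ^n =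
-- ζ^l = 1 pulls back to a point x ≠ 1 of μ at which C₂ / C₁ takes its value at 1. This is a
-- collision on μ and not yet one of f. If f is injective, r is already known to be coprime to q -
-- 1; hence f maps the (q-1)-th roots of unity onto all elements with that (q-1)-th power, and one
-- of them shares its value with u, although u^(q-1) ≠ 1. The hypothesis p ≠ 3 makes Q, R and S
-- units modulo 3, which is what leaves five of the eight coefficients.

-- Residues modulo 3 and sums of prime powers
module Exponents where
  open import Data.Nat.Base using (_+_; _*_; _^_; _≤_; _<_)
  open import Data.Nat.Properties using (_≟_)
  open import Relation.Binary.PropositionalEquality using (refl; sym; trans; cong; cong₂; subst; module ≡-Reasoning)

  infix 4 _≡₃_
  -- A record and not a synonym: an equation between remainders does not determine `m` and `n`, so
  -- they could not be inferred from it.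
  record _≡₃_ (m n : ℕ) : Set where
    constructor mod₃
    field residue : m % 3 ≡ n % 3

  open _≡₃_

  ≡₃-refl : ∀ {n} → n ≡₃ n
  ≡₃-refl = mod₃ refl

  ≡₃-+ : ∀ {m m′ n n′} → m ≡₃ m′ → n ≡₃ n′ → m + n ≡₃ m′ + n′
  ≡₃-+ {m} {m′} {n} {n′} m≡ n≡ = mod₃ (begin
    (m + n) % 3             ≡⟨ %-distribˡ-+ m n 3 ⟩
    (m % 3 + n % 3) % 3     ≡⟨ cong₂ (λ i j → (i + j) % 3) (residue m≡) (residue n≡) ⟩
    (m′ % 3 + n′ % 3) % 3   ≡⟨ %-distribˡ-+ m′ n′ 3 ⟨
    (m′ + n′) % 3           ∎)
    where open ≡-Reasoning

  ≡₃-* : ∀ {m m′ n n′} → m ≡₃ m′ → n ≡₃ n′ → m * n ≡₃ m′ * n′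
  ≡₃-* {m} {m′} {n} {n′} m≡ n≡ = mod₃ (begin
    (m * n) % 3               ≡⟨ %-distribˡ-* m n 3 ⟩
    (m % 3 * (n % 3)) % 3     ≡⟨ cong₂ (λ i j → (i * j) % 3) (residue m≡) (residue n≡) ⟩
    (m′ % 3 * (n′ % 3)) % 3   ≡⟨ %-distribˡ-* m′ n′ 3 ⟨
    (m′ * n′) % 3             ∎)
    where open ≡-Reasoning

  -- The map sending i to s - i on residues modulo 3 fixes exactly one residue, because 2 is
  -- invertible, and swaps the other two. The search runs through all 81 quadruples.
  residues-with-same-sum : ∀ {i} → i < 3 → ∀ {j} → j < 3 → ∀ {i′} → i′ < 3 → ∀ {j′} → j′ < 3 →
    (i + j) % 3 ≡ (i′ + j′) % 3 → ¬ (i′ ≡ j′) → i ≡ j ⊎ (i ≡ i′ × j ≡ j′) ⊎ (i ≡ j′ × j ≡ i′)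
  residues-with-same-sum = toWitness {a? =
    allUpTo? (λ i → allUpTo? (λ j → allUpTo? (λ i′ → allUpTo? (λ j′ →
      ((i + j) % 3 ≟ (i′ + j′) % 3) →-dec ¬? (i′ ≟ j′) →-dec
      ((i ≟ j) ⊎-dec ((i ≟ i′) ×-dec (j ≟ j′)) ⊎-dec ((i ≟ j′) ×-dec (j ≟ i′)))) 3) 3) 3) 3} tt

  same-sum-mod-3 : ∀ {m n m′ n′} → m + n ≡ m′ + n′ → ¬ (m′ ≡₃ n′) →
    m ≡₃ n ⊎ (m ≡₃ m′ × n ≡₃ n′) ⊎ (m ≡₃ n′ × n ≡₃ m′)
  same-sum-mod-3 {m} {n} {m′} {n′} eq m′≢n′
    with residues-with-same-sum (m%n<n m 3) (m%n<n n 3) (m%n<n m′ 3) (m%n<n n′ 3)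
           (trans (sym (%-distribˡ-+ m n 3)) (trans (cong (_% 3) eq) (%-distribˡ-+ m′ n′ 3)))
           (λ eq′ → m′≢n′ (mod₃ eq′))
  ... | inj₁ m≡n                = inj₁ (mod₃ m≡n)
  ... | inj₂ (inj₁ (m≡ , n≡))   = inj₂ (inj₁ (mod₃ m≡ , mod₃ n≡))
  ... | inj₂ (inj₂ (m≡ , n≡))   = inj₂ (inj₂ (mod₃ m≡ , mod₃ n≡))

  data Unit₃ (n : ℕ) : Set where
    one : n ≡₃ 1 → Unit₃ n
    two : n ≡₃ 2 → Unit₃ n

  Unit₃-* : ∀ {m n} → Unit₃ m → Unit₃ n → Unit₃ (m * n)
  Unit₃-* (one m≡) (one n≡) = one (≡₃-* m≡ n≡)
  Unit₃-* (one m≡) (two n≡) = two (≡₃-* m≡ n≡)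
  Unit₃-* (two m≡) (one n≡) = two (≡₃-* m≡ n≡)
  Unit₃-* (two m≡) (two n≡) = one (mod₃ (residue (≡₃-* m≡ n≡)))

  Unit₃-^ : ∀ {m} i → Unit₃ m → Unit₃ (m ^ i)
  Unit₃-^ zero    u = one ≡₃-refl
  Unit₃-^ (suc i) u = Unit₃-* u (Unit₃-^ i u)

  prime-Unit₃ : ∀ {p} → Prime p → p ≢ 3 → Unit₃ p
  prime-Unit₃ {p} p-prime p≢3 = fromResidue (p % 3) (m%n<n p 3) refl
    where
    fromResidue : ∀ i → i < 3 → p % 3 ≡ i → Unit₃ p
    fromResidue 0 _ eq with prime⇒irreducible p-prime (m%n≡0⇒n∣m p 3 eq)
    ... | inj₁ ()
    ... | inj₂ 3≡p = contradiction (sym 3≡p) p≢3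
    fromResidue 1 _ eq = one (mod₃ eq)
    fromResidue 2 _ eq = two (mod₃ eq)
    fromResidue (suc (suc (suc i))) (s≤s (s≤s (s≤s ()))) eq

  -- The pair (u , v) stands for the term (ω ^ u - ω ^ v) X ^ u of C₁.
  exponentPairs : ℕ → ℕ → ℕ → List (ℕ × ℕ)
  exponentPairs Q R S
    = (Q + R + S , 1)
    ∷ (Q + R     , S + 1)
    ∷ (Q + S     , R + 1)
    ∷ (R + S     , Q + 1)
    ∷ (Q         , R + S + 1)
    ∷ (R         , Q + S + 1)
    ∷ (S         , Q + R + 1)
    ∷ (0         , Q + R + S + 1)
    ∷ []

  exponentPairs-sum : ∀ Q R S → All (λ (u , v) → u + v ≡ Q + R + S + 1) (exponentPairs Q R S)
  exponentPairs-sum Q R S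
    = refl ∷ sum₂ Q R S ∷ sum₃ Q R S ∷ sum₄ Q R S ∷ sum₅ Q R S ∷ sum₆ Q R S ∷ sum₇ Q R S ∷ refl ∷ []
    where
    sum₂ : ∀ Q R S → Q + R + (S + 1) ≡ Q + R + S + 1
    sum₂ = solve-∀
    sum₃ : ∀ Q R S → Q + S + (R + 1) ≡ Q + R + S + 1
    sum₃ = solve-∀
    sum₄ : ∀ Q R S → R + S + (Q + 1) ≡ Q + R + S + 1
    sum₄ = solve-∀
    sum₅ : ∀ Q R S → Q + (R + S + 1) ≡ Q + R + S + 1
    sum₅ = solve-∀
    sum₆ : ∀ Q R S → R + (Q + S + 1) ≡ Q + R + S + 1
    sum₆ = solve-∀
    sum₇ : ∀ Q R S → S + (Q + R + 1) ≡ Q + R + S + 1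
    sum₇ = solve-∀

  nonvanishing : ℕ × ℕ → Bool
  nonvanishing (u , v) = not (does (u % 3 ≟ v % 3))

  nonvanishing-cong : ∀ {u u′ v v′} → u ≡₃ u′ → v ≡₃ v′ → nonvanishing (u , v) ≡ nonvanishing (u′ , v′)
  nonvanishing-cong u≡ v≡ = cong₂ (λ i j → not (does (i ≟ j))) (residue u≡) (residue v≡)

  -- The pattern of vanishing coefficients depends only on residues, so it can be computed at eight
  -- representatives.
  nonvanishing-exponentPairs : ∀ {Q R S i j k} → Q ≡₃ i → R ≡₃ j → S ≡₃ k →
    map nonvanishing (exponentPairs Q R S) ≡ map nonvanishing (exponentPairs i j k)
  nonvanishing-exponentPairs Q≡ R≡ S≡ =
    cong₂ _∷_ (nonvanishing-cong (≡₃-+ (≡₃-+ Q≡ R≡) S≡) (≡₃-refl {1})) (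
    cong₂ _∷_ (nonvanishing-cong (≡₃-+ Q≡ R≡) (≡₃-+ S≡ (≡₃-refl {1}))) (
    cong₂ _∷_ (nonvanishing-cong (≡₃-+ Q≡ S≡) (≡₃-+ R≡ (≡₃-refl {1}))) (
    cong₂ _∷_ (nonvanishing-cong (≡₃-+ R≡ S≡) (≡₃-+ Q≡ (≡₃-refl {1}))) (
    cong₂ _∷_ (nonvanishing-cong Q≡ (≡₃-+ (≡₃-+ R≡ S≡) (≡₃-refl {1}))) (
    cong₂ _∷_ (nonvanishing-cong R≡ (≡₃-+ (≡₃-+ Q≡ S≡) (≡₃-refl {1}))) (
    cong₂ _∷_ (nonvanishing-cong S≡ (≡₃-+ (≡₃-+ Q≡ R≡) (≡₃-refl {1}))) (
    cong₂ _∷_ (nonvanishing-cong (≡₃-refl {0}) (≡₃-+ (≡₃-+ (≡₃-+ Q≡ R≡) S≡) (≡₃-refl {1}))) refl)))))))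

  count : List Bool → ℕ
  count bs = length (filterᵇ (λ b → b) bs)

  -- With n = Q + R + S, a pair vanishes iff its first entry is ≡ -(n + 1). Among the eight subset
  -- sums of three units modulo 3 the residue -n occurs twice and each other residue three times, so
  -- exactly three pairs drop out.
  count-nonvanishing : ∀ {Q R S} → Unit₃ Q → Unit₃ R → Unit₃ S →
    count (map nonvanishing (exponentPairs Q R S)) ≡ 5
  count-nonvanishing (one Q≡) (one R≡) (one S≡) = cong count (nonvanishing-exponentPairs Q≡ R≡ S≡)
  count-nonvanishing (one Q≡) (one R≡) (two S≡) = cong count (nonvanishing-exponentPairs Q≡ R≡ S≡)
  count-nonvanishing (one Q≡) (two R≡) (one S≡) = cong count (nonvanishing-exponentPairs Q≡ R≡ S≡)
  count-nonvanishing (one Q≡) (two R≡) (two S≡) = cong count (nonvanishing-exponentPairs Q≡ R≡ S≡)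
  count-nonvanishing (two Q≡) (one R≡) (one S≡) = cong count (nonvanishing-exponentPairs Q≡ R≡ S≡)
  count-nonvanishing (two Q≡) (one R≡) (two S≡) = cong count (nonvanishing-exponentPairs Q≡ R≡ S≡)
  count-nonvanishing (two Q≡) (two R≡) (one S≡) = cong count (nonvanishing-exponentPairs Q≡ R≡ S≡)
  count-nonvanishing (two Q≡) (two R≡) (two S≡) = cong count (nonvanishing-exponentPairs Q≡ R≡ S≡)

  -- Otherwise 2 n ≡ 0, as the difference of m + n ≡ 1 and m - n ≡ 1.
  m+n≡₃1⇒m≢₃n+1 : ∀ {m n} → Unit₃ n → m + n ≡₃ 1 → ¬ (m ≡₃ n + 1)
  m+n≡₃1⇒m≢₃n+1 (one n≡1) m+n≡1 m≡n+1 with () ←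
    trans (sym (residue m+n≡1)) (trans (residue (≡₃-+ m≡n+1 n≡1)) (residue (≡₃-+ (≡₃-+ n≡1 (≡₃-refl {1})) (≡₃-refl {1}))))
  m+n≡₃1⇒m≢₃n+1 (two n≡2) m+n≡1 m≡n+1 with () ←
    trans (sym (residue m+n≡1)) (trans (residue (≡₃-+ m≡n+1 n≡2)) (residue (≡₃-+ (≡₃-+ n≡2 (≡₃-refl {1})) (≡₃-refl {2}))))

  -- For k ≤ i the right-hand side is too small. Otherwise division by `p ^ i` leaves 1 plus a
  -- multiple of p on the left and a multiple of p on the right. The strict inequality excludes 2^i
  -- + 2^i = 2^(i+1).
  ^-sum-≢-^ : ∀ {p} → Prime p → ∀ {i j} k → i < j → p ^ i + p ^ j ≢ p ^ k
  ^-sum-≢-^ {p} p-prime {i} {j} k i<j eq with k ℕ.≤? i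
  ... | yes k≤i = ℕ.<⇒≢ (begin-strict
    p ^ k           ≤⟨ ℕ.^-monoʳ-≤ p k≤i ⟩
    p ^ i           <⟨ ℕ.m<m+n (p ^ i) (ℕ.m^n>0 p j) ⟩
    p ^ i + p ^ j   ∎) (sym eq)
    where
    open ℕ.≤-Reasoning
    instance _ = prime⇒nonZero p-prime
  ... | no k≰i = ¬prime[1] (subst Prime (∣1⇒≡1 p∣1) p-prime)
    where
    instance _ = prime⇒nonZero p-prime
    instance _ = ℕ.m^n≢0 p i
    open ≡-Reasoning
    p^[1+k] : ∀ {l} → i < l → p ^ l ≡ p ^ i * (p * p ^ (l ∸ suc i))
    p^[1+k] {l} i<l = begin
      p ^ l                               ≡⟨ cong (p ^_) (ℕ.m+[n∸m]≡n i<l) ⟨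
      p ^ (suc i + (l ∸ suc i))           ≡⟨ ℕ.^-distribˡ-+-* p (suc i) (l ∸ suc i) ⟩
      p * p ^ i * p ^ (l ∸ suc i)         ≡⟨ cong (_* p ^ (l ∸ suc i)) (ℕ.*-comm p (p ^ i)) ⟩
      p ^ i * p * p ^ (l ∸ suc i)         ≡⟨ ℕ.*-assoc (p ^ i) p _ ⟩
      p ^ i * (p * p ^ (l ∸ suc i))       ∎
    cancelled : p * p ^ (j ∸ suc i) + 1 ≡ p * p ^ (k ∸ suc i)
    cancelled = ℕ.*-cancelˡ-≡ _ _ (p ^ i) (begin
      p ^ i * (p * p ^ (j ∸ suc i) + 1)             ≡⟨ ℕ.*-distribˡ-+ (p ^ i) _ 1 ⟩
      p ^ i * (p * p ^ (j ∸ suc i)) + p ^ i * 1     ≡⟨ cong₂ _+_ (sym (p^[1+k] i<j)) (ℕ.*-identityʳ (p ^ i)) ⟩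
      p ^ j + p ^ i                                 ≡⟨ ℕ.+-comm (p ^ j) (p ^ i) ⟩
      p ^ i + p ^ j                                 ≡⟨ eq ⟩
      p ^ k                                         ≡⟨ p^[1+k] (ℕ.≰⇒> k≰i) ⟩
      p ^ i * (p * p ^ (k ∸ suc i))                 ∎)
    p∣1 : p ∣ 1
    p∣1 = ∣m+n∣m⇒∣n (subst (p ∣_) (sym cancelled) (m∣m*n (p ^ (k ∸ suc i)))) (m∣m*n (p ^ (j ∸ suc i)))

  powers-sum-≢ : ∀ {p Q R S} → Prime p → IsPowerOf p Q → IsPowerOf p R → IsPowerOf p S → Q ≢ R → Q + R ≢ S
  powers-sum-≢ {p} p-prime (i , refl) (j , refl) (k , refl) Q≢R eq with ℕ.<-cmp i j
  ... | tri< i<j _ _ = ^-sum-≢-^ p-prime k i<j eq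
  ... | tri≈ _ i≡j _ = Q≢R (cong (p ^_) i≡j)
  ... | tri> _ _ j<i = ^-sum-≢-^ p-prime k j<i (trans (ℕ.+-comm (p ^ j) (p ^ i)) eq)

  m+n≢m : ∀ {m n} → 0 < n → m + n ≢ m
  m+n≢m {m} {n} 0<n eq = ℕ.<⇒≢ (ℕ.m<m+n m 0<n) (sym eq)

  -- The exponents are the subset sums of Q, R and S. Once common summands are cancelled, a
  -- coincidence says that two of the numbers are equal, that one is the sum of the other two, or
  -- that a positive number is 0.
  distinct-exponents : ∀ {Q R S} → 0 < Q → 0 < R → 0 < S →
    Q ≢ R → Q ≢ S → R ≢ S → Q + R ≢ S → Q + S ≢ R → R + S ≢ Q →
    Unique (map proj₁ (exponentPairs Q R S))
  distinct-exponents {Q} {R} {S} 0<Q 0<R 0<S Q≢R Q≢S R≢S Q+R≢S Q+S≢R R+S≢Q =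
      (m+n≢m 0<S ∷ larger 0<R (n≡₁ Q R S) ∷ larger 0<Q (n≡₂ Q R S) ∷ larger 0<R+S (n≡₃ Q R S)
        ∷ larger 0<Q+S (n≡₄ Q R S) ∷ larger 0<Q+R (n≡₅ Q R S) ∷ ℕ.>⇒≢ 0<n ∷ [])
    ∷ ((λ eq → R≢S (ℕ.+-cancelˡ-≡ Q R S eq)) ∷ (λ eq → Q≢S (ℕ.+-cancelˡ-≡ R Q S (trans (ℕ.+-comm R Q) eq)))
        ∷ m+n≢m 0<R ∷ larger 0<Q (ℕ.+-comm R Q) ∷ Q+R≢S ∷ ℕ.>⇒≢ 0<Q+R ∷ [])
    ∷ ((λ eq → Q≢R (ℕ.+-cancelʳ-≡ S Q R eq)) ∷ m+n≢m 0<S ∷ Q+S≢R ∷ larger 0<Q (ℕ.+-comm S Q) ∷ ℕ.>⇒≢ 0<Q+S ∷ [])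
    ∷ (R+S≢Q ∷ m+n≢m 0<S ∷ larger 0<R (ℕ.+-comm S R) ∷ ℕ.>⇒≢ 0<R+S ∷ [])
    ∷ (Q≢R ∷ Q≢S ∷ ℕ.>⇒≢ 0<Q ∷ [])
    ∷ (R≢S ∷ ℕ.>⇒≢ 0<R ∷ [])
    ∷ (ℕ.>⇒≢ 0<S ∷ [])
    ∷ [] ∷ []
    where
    larger : ∀ {m n o} → 0 < n → m + n ≡ o → o ≢ m
    larger 0<n refl = m+n≢m 0<n
    0<Q+R : 0 < Q + R
    0<Q+R = ℕ.≤-trans 0<Q (ℕ.m≤m+n Q R)
    0<Q+S : 0 < Q + S
    0<Q+S = ℕ.≤-trans 0<Q (ℕ.m≤m+n Q S)
    0<R+S : 0 < R + S
    0<R+S = ℕ.≤-trans 0<R (ℕ.m≤m+n R S)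
    0<n : 0 < Q + R + S
    0<n = ℕ.≤-trans 0<Q+R (ℕ.m≤m+n (Q + R) S)
    n≡₁ : ∀ Q R S → Q + S + R ≡ Q + R + S
    n≡₁ = solve-∀
    n≡₂ : ∀ Q R S → R + S + Q ≡ Q + R + S
    n≡₂ = solve-∀
    n≡₃ : ∀ Q R S → Q + (R + S) ≡ Q + R + S
    n≡₃ = solve-∀
    n≡₄ : ∀ Q R S → R + (Q + S) ≡ Q + R + S
    n≡₄ = solve-∀
    n≡₅ : ∀ Q R S → S + (Q + R) ≡ Q + R + S
    n≡₅ = solve-∀

  exponentPairs-≤ : ∀ Q R S → All (λ e → proj₁ e ≤ Q + R + S) (exponentPairs Q R S)
  exponentPairs-≤ Q R S
    = ℕ.≤-refl ∷ ℕ.m≤m+n (Q + R) S ∷ ℕ.+-monoˡ-≤ S (ℕ.m≤m+n Q R) ∷ ℕ.+-monoˡ-≤ S (ℕ.m≤n+m R Q)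
    ∷ ℕ.≤-trans (ℕ.m≤m+n Q R) (ℕ.m≤m+n (Q + R) S) ∷ ℕ.≤-trans (ℕ.m≤n+m R Q) (ℕ.m≤m+n (Q + R) S)
    ∷ ℕ.m≤n+m S (Q + R) ∷ z≤n ∷ []

  -- Truncated subtraction from n is injective only up to n; with `exponentPairs-≤` this carries
  -- distinctness of exponents from `C₁` over to `C₂`.
  Unique-∸ : ∀ {n} {A : Set} {f : A → ℕ} {xs} → All (λ x → f x ≤ n) xs →
    Unique (map f xs) → Unique (map (n ∸_) (map f xs))
  Unique-∸ []           []        = []
  Unique-∸ {n} {f = f} {x ∷ xs} (x≤n ∷ ≤n) (x∉ ∷ u) = distinct ≤n x∉ ∷ Unique-∸ ≤n u
    where
    distinct : ∀ {ys} → All (λ y → f y ≤ n) ys → All (f x ≢_) (map f ys) →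
      All (n ∸ f x ≢_) (map (n ∸_) (map f ys))
    distinct {[]}     []         []          = []
    distinct {y ∷ ys} (y≤n ∷ ≤n) (x≢y ∷ x≢) = (λ eq → x≢y (ℕ.∸-cancelˡ-≡ x≤n y≤n eq)) ∷ distinct ≤n x≢

open Exponents

-- Fields

-- The ring solver must compute with its coefficients to see that terms cancel. Those of an abstract
-- ring are opaque, so integers are mapped into it.
module IntegerCoefficients {c ℓ} (A : CommutativeRing c ℓ) where
  open CommutativeRing A
  open import Algebra.Properties.Ring ring
  open import Algebra.Properties.AbelianGroup +-abelianGroup using (⁻¹-∙-comm; ⁻¹-involutive; ε⁻¹≈ε)
  open import Algebra.Properties.CommutativeSemigroup +-commutativeSemigroup using (interchange)
  open import Algebra.Properties.Semiring.Mult.TCOptimised semiring using (1+×; ×-homo-+; ×1-homo-*) renaming (_×_ to _·_)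
  open import Relation.Binary.Reasoning.Setoid setoid

  fromℤ : ℤ → Carrier
  fromℤ (+ n)    = n · 1#
  fromℤ -[1+ n ] = - (suc n · 1#)

  fromℤ-neg : ∀ i → fromℤ (ℤ.- i) ≈ - fromℤ i
  fromℤ-neg (+ zero)  = sym ε⁻¹≈ε
  fromℤ-neg (+ suc n) = refl
  fromℤ-neg -[1+ n ]  = sym (⁻¹-involutive _)

  fromℤ-⊖ : ∀ m n → fromℤ (m ⊖ n) ≈ m · 1# - n · 1#
  fromℤ-⊖ m       zero    = sym (trans (+-congˡ ε⁻¹≈ε) (+-identityʳ _))
  fromℤ-⊖ zero    (suc n) = sym (+-identityˡ _)
  fromℤ-⊖ (suc m) (suc n) = begin
    fromℤ (suc m ⊖ suc n)               ≡⟨ ≡.cong fromℤ (ℤ.[1+m]⊖[1+n]≡m⊖n m n) ⟩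
    fromℤ (m ⊖ n)                       ≈⟨ fromℤ-⊖ m n ⟩
    m · 1# - n · 1#                     ≈⟨ +-identityˡ _ ⟨
    0# + (m · 1# - n · 1#)              ≈⟨ +-congʳ (-‿inverseʳ 1#) ⟨
    (1# - 1#) + (m · 1# - n · 1#)       ≈⟨ interchange _ _ _ _ ⟩
    (1# + m · 1#) + (- 1# - n · 1#)     ≈⟨ +-congˡ (⁻¹-∙-comm _ _) ⟩
    (1# + m · 1#) - (1# + n · 1#)       ≈⟨ +-cong (1+× m 1#) (-‿cong (1+× n 1#)) ⟨
    suc m · 1# - suc n · 1#             ∎

  fromℤ-+ : ∀ i j → fromℤ (i ℤ.+ j) ≈ fromℤ i + fromℤ j
  fromℤ-+ (+ m)    (+ n)    = ×-homo-+ 1# m n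
  fromℤ-+ (+ m)    -[1+ n ] = fromℤ-⊖ m (suc n)
  fromℤ-+ -[1+ m ] (+ n)    = trans (fromℤ-⊖ n (suc m)) (+-comm _ _)
  fromℤ-+ -[1+ m ] -[1+ n ] = begin
    fromℤ (-[1+ m ] ℤ.+ -[1+ n ])            ≡⟨ ≡.cong fromℤ (ℤ.neg-distrib-+ (+ suc m) (+ suc n)) ⟨
    fromℤ (ℤ.- (+ (suc m ℕ.+ suc n)))        ≈⟨ fromℤ-neg (+ (suc m ℕ.+ suc n)) ⟩
    - ((suc m ℕ.+ suc n) · 1#)               ≈⟨ -‿cong (×-homo-+ 1# (suc m) (suc n)) ⟩
    - (suc m · 1# + suc n · 1#)              ≈⟨ ⁻¹-∙-comm _ _ ⟨
    - (suc m · 1#) - suc n · 1#              ∎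

  fromℤ-+* : ∀ m j → fromℤ (+ m ℤ.* j) ≈ m · 1# * fromℤ j
  fromℤ-+* m (+ n)    = trans (reflexive (≡.cong fromℤ (≡.sym (ℤ.pos-* m n)))) (×1-homo-* m n)
  fromℤ-+* m -[1+ n ] = begin
    fromℤ (+ m ℤ.* -[1+ n ])        ≡⟨ ≡.cong fromℤ (ℤ.neg-distribʳ-* (+ m) (+ suc n)) ⟨
    fromℤ (ℤ.- (+ m ℤ.* + suc n))   ≈⟨ fromℤ-neg (+ m ℤ.* + suc n) ⟩
    - fromℤ (+ m ℤ.* + suc n)       ≈⟨ -‿cong (fromℤ-+* m (+ suc n)) ⟩
    - (m · 1# * suc n · 1#)         ≈⟨ -‿distribʳ-* _ _ ⟩
    m · 1# * - (suc n · 1#)         ∎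

  fromℤ-* : ∀ i j → fromℤ (i ℤ.* j) ≈ fromℤ i * fromℤ j
  fromℤ-* (+ m)    j = fromℤ-+* m j
  fromℤ-* -[1+ m ] j = begin
    fromℤ (-[1+ m ] ℤ.* j)          ≡⟨ ≡.cong fromℤ (ℤ.neg-distribˡ-* (+ suc m) j) ⟨
    fromℤ (ℤ.- (+ suc m ℤ.* j))     ≈⟨ fromℤ-neg (+ suc m ℤ.* j) ⟩
    - fromℤ (+ suc m ℤ.* j)         ≈⟨ -‿cong (fromℤ-+* (suc m) j) ⟩
    - (suc m · 1# * fromℤ j)        ≈⟨ -‿distribˡ-* _ _ ⟩
    - (suc m · 1#) * fromℤ j        ∎

  morphism : ℤ.+-*-rawRing -Raw-AlmostCommutative⟶ fromCommutativeRing A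
  morphism = record
    { ⟦_⟧    = fromℤ
    ; +-homo = fromℤ-+
    ; *-homo = fromℤ-*
    ; -‿homo = fromℤ-neg
    ; 0-homo = refl
    ; 1-homo = refl
    }

  fromℤ-≟ : ∀ i j → Maybe (fromℤ i ≈ fromℤ j)
  fromℤ-≟ i j = Maybe.map (λ i≡j → reflexive (≡.cong fromℤ i≡j)) (dec⇒maybe (i ℤ.≟ j))

  open import Algebra.Solver.Ring ℤ.+-*-rawRing (fromCommutativeRing A) morphism fromℤ-≟ public
    using (solve; _:=_; _:+_; _:*_; _:-_; :-_; _:^_; con)

gcd≢1⇒1<gcd : ∀ {m n} → 0 ℕ.< m → ¬ (gcd m n ≡ 1) → 1 ℕ.< gcd m n
gcd≢1⇒1<gcd {m} {n} 0<m ≢1 = ℕ.≤∧≢⇒<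
  (ℕ.n≢0⇒n>0 λ gcd≡0 → ℕ.>⇒≢ 0<m (gcd[m,n]≡0⇒m≡0 gcd≡0)) (λ 1≡gcd → ≢1 (≡.sym 1≡gcd))

-- Powers, roots of unity and roots of polynomials

module Powers {c ℓ} (A : CommutativeRing c ℓ) where
  open CommutativeRing A
  open import Algebra.Properties.CommutativeSemiring.Exp commutativeSemiring
  open import Relation.Binary.Reasoning.Setoid setoid

  1^n≈1 : ∀ n → 1# ^ n ≈ 1#
  1^n≈1 zero    = refl
  1^n≈1 (suc n) = trans (*-identityˡ _) (1^n≈1 n)

  ^-comm : ∀ x m n → (x ^ m) ^ n ≈ (x ^ n) ^ m
  ^-comm x m n = begin
    (x ^ m) ^ n   ≈⟨ ^-assocʳ x m n ⟩
    x ^ (m ℕ.* n) ≈⟨ ^-congʳ x (ℕ.*-comm m n) ⟩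
    x ^ (n ℕ.* m) ≈⟨ ^-assocʳ x n m ⟨
    (x ^ n) ^ m   ∎

  ^-*≈1 : ∀ {x} m n → x ^ m ≈ 1# → x ^ (n ℕ.* m) ≈ 1#
  ^-*≈1 {x} m n xᵐ≈1 = begin
    x ^ (n ℕ.* m) ≈⟨ ^-congʳ x (ℕ.*-comm n m) ⟩
    x ^ (m ℕ.* n) ≈⟨ ^-assocʳ x m n ⟨
    (x ^ m) ^ n   ≈⟨ ^-congˡ n xᵐ≈1 ⟩
    1# ^ n        ≈⟨ 1^n≈1 n ⟩
    1#            ∎

  ^-+* : ∀ {x} m k n → x ^ m ≈ 1# → x ^ (k ℕ.+ n ℕ.* m) ≈ x ^ k
  ^-+* {x} m k n xᵐ≈1 = begin
    x ^ (k ℕ.+ n ℕ.* m)     ≈⟨ ^-homo-* x k _ ⟩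
    x ^ k * x ^ (n ℕ.* m)   ≈⟨ *-congˡ (^-*≈1 m n xᵐ≈1) ⟩
    x ^ k * 1#              ≈⟨ *-identityʳ _ ⟩
    x ^ k                   ∎

  ^-gcd≈1 : ∀ {x} m n → x ^ m ≈ 1# → x ^ n ≈ 1# → x ^ gcd m n ≈ 1#
  ^-gcd≈1 {x} m n xᵐ≈1 xⁿ≈1 with Bézout.identity (gcd-GCD m n)
  ... | Bézout.+- i j eq = begin
    x ^ gcd m n                 ≈⟨ ^-+* n (gcd m n) j xⁿ≈1 ⟨
    x ^ (gcd m n ℕ.+ j ℕ.* n)   ≡⟨ ≡.cong (x ^_) eq ⟩
    x ^ (i ℕ.* m)               ≈⟨ ^-*≈1 m i xᵐ≈1 ⟩
    1#                          ∎
  ... | Bézout.-+ i j eq = begin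
    x ^ gcd m n                 ≈⟨ ^-+* m (gcd m n) i xᵐ≈1 ⟨
    x ^ (gcd m n ℕ.+ i ℕ.* m)   ≡⟨ ≡.cong (x ^_) eq ⟩
    x ^ (j ℕ.* n)               ≈⟨ ^-*≈1 n j xⁿ≈1 ⟩
    1#                          ∎

  AdditiveExponent : ℕ → Set _
  AdditiveExponent n = ∀ x y → (x + y) ^ n ≈ x ^ n + y ^ n

  ≈0⇒^≈0 : ∀ {x n} → 0 ℕ.< n → x ≈ 0# → x ^ n ≈ 0#
  ≈0⇒^≈0 (s≤s _) x≈0 = trans (*-congʳ x≈0) (zeroˡ _)

  ^-∣≈1 : ∀ {x m n} → m ∣ n → x ^ m ≈ 1# → x ^ n ≈ 1#
  ^-∣≈1 {m = m} (divides k ≡.refl) = ^-*≈1 m k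

  ^-cong-% : ∀ {x} m n k → x ^ suc k ≈ 1# → m % suc k ≡ n % suc k → x ^ m ≈ x ^ n
  ^-cong-% {x} m n k x^≈1 eq = begin
    x ^ m                                       ≡⟨ ≡.cong (x ^_) (m≡m%n+[m/n]*n m (suc k)) ⟩
    x ^ (m % suc k ℕ.+ m / suc k ℕ.* suc k)     ≈⟨ ^-+* (suc k) (m % suc k) (m / suc k) x^≈1 ⟩
    x ^ (m % suc k)                             ≡⟨ ≡.cong (x ^_) eq ⟩
    x ^ (n % suc k)                             ≈⟨ ^-+* (suc k) (n % suc k) (n / suc k) x^≈1 ⟨
    x ^ (n % suc k ℕ.+ n / suc k ℕ.* suc k)     ≡⟨ ≡.cong (x ^_) (m≡m%n+[m/n]*n n (suc k)) ⟨
    x ^ n                                       ∎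

-- Replaces apartness by a decision: each element is zero or has an inverse, so that negated
-- equality to zero yields an inverse.
record IsDiscreteField {c ℓ} (A : CommutativeRing c ℓ) : Set (c ⊔ ℓ) where
  open CommutativeRing A
  field
    1≉0  : ¬ (1# ≈ 0#)
    inv? : ∀ x → x ≈ 0# ⊎ ∃ λ y → x * y ≈ 1#

module DiscreteField {c ℓ} (A : CommutativeRing c ℓ) (isDiscreteField : IsDiscreteField A) where
  open CommutativeRing A renaming (zero to *-zero)
  open IsDiscreteField isDiscreteField
  open import Algebra.Properties.CommutativeSemiring.Exp commutativeSemiring
  open import Algebra.Properties.AbelianGroup +-abelianGroup using (x∙y⁻¹≈ε⇒x≈y)
  open import Relation.Binary.Reasoning.Setoid setoid
  open IntegerCoefficients A
  open Powers A

  inverse : ∀ {x} → ¬ (x ≈ 0#) → ∃ λ y → x * y ≈ 1#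
  inverse {x} x≉0 with inv? x
  ... | inj₁ x≈0 = contradiction x≈0 x≉0
  ... | inj₂ x⁻¹ = x⁻¹

  *-cancelˡ : ∀ {x y z} → ¬ (x ≈ 0#) → x * y ≈ x * z → y ≈ z
  *-cancelˡ {x} {y} {z} x≉0 xy≈xz with x⁻¹ , xx⁻¹≈1 ← inverse x≉0 = begin
    y               ≈⟨ *-identityˡ y ⟨
    1# * y          ≈⟨ *-congʳ xx⁻¹≈1 ⟨
    x * x⁻¹ * y     ≈⟨ solve 3 (λ x i y → x :* i :* y := i :* (x :* y)) refl x x⁻¹ y ⟩
    x⁻¹ * (x * y)   ≈⟨ *-congˡ xy≈xz ⟩
    x⁻¹ * (x * z)   ≈⟨ solve 3 (λ x i y → x :* i :* y := i :* (x :* y)) refl x x⁻¹ z ⟨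
    x * x⁻¹ * z     ≈⟨ *-congʳ xx⁻¹≈1 ⟩
    1# * z          ≈⟨ *-identityˡ z ⟩
    z               ∎

  *-cancelʳ : ∀ {x y z} → ¬ (x ≈ 0#) → y * x ≈ z * x → y ≈ z
  *-cancelʳ x≉0 yx≈zx = *-cancelˡ x≉0 (trans (*-comm _ _) (trans yx≈zx (*-comm _ _)))

  *≈0 : ∀ {x y} → ¬ (x ≈ 0#) → x * y ≈ 0# → y ≈ 0#
  *≈0 x≉0 xy≈0 = *-cancelˡ x≉0 (trans xy≈0 (sym (zeroʳ _)))

  *≉0 : ∀ {x y} → ¬ (x ≈ 0#) → ¬ (y ≈ 0#) → ¬ (x * y ≈ 0#)
  *≉0 x≉0 y≉0 xy≈0 = y≉0 (*≈0 x≉0 xy≈0)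

  ^≉0 : ∀ {x} n → ¬ (x ≈ 0#) → ¬ (x ^ n ≈ 0#)
  ^≉0 zero    x≉0 = 1≉0
  ^≉0 (suc n) x≉0 = *≉0 x≉0 (^≉0 n x≉0)

  ^≈0⇒≈0 : ∀ {x} n → x ^ n ≈ 0# → x ≈ 0#
  ^≈0⇒≈0 {x} n xⁿ≈0 with inv? x
  ... | inj₁ x≈0       = x≈0
  ... | inj₂ (y , xy≈1) = contradiction xⁿ≈0 (^≉0 n λ x≈0 →
    1≉0 (trans (sym xy≈1) (trans (*-congʳ x≈0) (zeroˡ y))))

  ≉⇒-≉0 : ∀ {x y} → ¬ (x ≈ y) → ¬ (x - y ≈ 0#)
  ≉⇒-≉0 x≉y x-y≈0 = x≉y (x∙y⁻¹≈ε⇒x≈y _ _ x-y≈0)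

  -- The m-th and the n-th power of x / y are 1, hence so is the power with exponent `gcd m n`.
  coprime-powers-injective : ∀ {x y} m n → gcd m n ≡ 1 → ¬ (y ≈ 0#) →
    x ^ m ≈ y ^ m → x ^ n ≈ y ^ n → x ≈ y
  coprime-powers-injective {x} {y} m n gcd≡1 y≉0 xᵐ≈yᵐ xⁿ≈yⁿ
    with y⁻¹ , yy⁻¹≈1 ← inverse y≉0 = begin
    x               ≈⟨ *-identityʳ x ⟨
    x * 1#          ≈⟨ *-congˡ yy⁻¹≈1 ⟨
    x * (y * y⁻¹)   ≈⟨ solve 3 (λ x y i → x :* (y :* i) := y :* (x :* i)) refl x y y⁻¹ ⟩
    y * (x * y⁻¹)   ≈⟨ *-congˡ x/y≈1 ⟩
    y * 1#          ≈⟨ *-identityʳ y ⟩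
    y               ∎
    where
    [x/y]^≈1 : ∀ k → x ^ k ≈ y ^ k → (x * y⁻¹) ^ k ≈ 1#
    [x/y]^≈1 k eq = begin
      (x * y⁻¹) ^ k     ≈⟨ ^-distrib-* x y⁻¹ k ⟩
      x ^ k * y⁻¹ ^ k   ≈⟨ *-congʳ eq ⟩
      y ^ k * y⁻¹ ^ k   ≈⟨ ^-distrib-* y y⁻¹ k ⟨
      (y * y⁻¹) ^ k     ≈⟨ ^-congˡ k yy⁻¹≈1 ⟩
      1# ^ k            ≈⟨ 1^n≈1 k ⟩
      1#                ∎
    x/y≈1 : x * y⁻¹ ≈ 1#
    x/y≈1 = begin
      x * y⁻¹              ≈⟨ *-identityʳ _ ⟨
      (x * y⁻¹) ^ 1        ≡⟨ ≡.cong ((x * y⁻¹) ^_) gcd≡1 ⟨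
      (x * y⁻¹) ^ gcd m n  ≈⟨ ^-gcd≈1 m n ([x/y]^≈1 m xᵐ≈yᵐ) ([x/y]^≈1 n xⁿ≈yⁿ) ⟩
      1#                   ∎

  -- On the n-th roots of unity the m-th power map is inverted by a Bézout coefficient of m.
  coprime-root : ∀ {x} m n → gcd m n ≡ 1 → ¬ (x ≈ 0#) → x ^ n ≈ 1# →
    ∃ λ y → y ^ m ≈ x × y ^ n ≈ 1#
  coprime-root {x} m n gcd≡1 x≉0 xⁿ≈1 with Bézout.identity (gcd-GCD m n)
  ... | Bézout.+- i j eq = x ^ i , (begin
    (x ^ i) ^ m               ≈⟨ ^-assocʳ x i m ⟩
    x ^ (i ℕ.* m)             ≡⟨ ≡.cong (x ^_) eq ⟨
    x ^ (gcd m n ℕ.+ j ℕ.* n) ≈⟨ ^-+* n (gcd m n) j xⁿ≈1 ⟩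
    x ^ gcd m n               ≡⟨ ≡.cong (x ^_) gcd≡1 ⟩
    x ^ 1                     ≈⟨ *-identityʳ x ⟩
    x                         ∎)
    , trans (^-comm x i n) (trans (^-congˡ i xⁿ≈1) (1^n≈1 i))
  -- Here the coefficient of m is -i, so the i-th power of the inverse of x is taken.
  ... | Bézout.-+ i j eq with y , xy≈1 ← inverse x≉0 = y ^ i , (begin
    (y ^ i) ^ m                         ≈⟨ *-identityʳ _ ⟨
    (y ^ i) ^ m * 1#                    ≈⟨ *-congˡ xx^im≈1 ⟨
    (y ^ i) ^ m * (x * (x ^ i) ^ m)     ≈⟨ solve 3 (λ a x b → a :* (x :* b) := x :* (b :* a)) refl _ x _ ⟩
    x * ((x ^ i) ^ m * (y ^ i) ^ m)     ≈⟨ *-congˡ (^-distrib-* (x ^ i) (y ^ i) m) ⟨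
    x * (x ^ i * y ^ i) ^ m             ≈⟨ *-congˡ (^-congˡ m (x^y^≈1 i)) ⟩
    x * 1# ^ m                          ≈⟨ *-congˡ (1^n≈1 m) ⟩
    x * 1#                              ≈⟨ *-identityʳ x ⟩
    x                                   ∎)
    , (begin
    (y ^ i) ^ n                         ≈⟨ ^-comm y i n ⟩
    (y ^ n) ^ i                         ≈⟨ ^-congˡ i (*-identityˡ _) ⟨
    (1# * y ^ n) ^ i                    ≈⟨ ^-congˡ i (*-congʳ xⁿ≈1) ⟨
    (x ^ n * y ^ n) ^ i                 ≈⟨ ^-congˡ i (x^y^≈1 n) ⟩
    1# ^ i                              ≈⟨ 1^n≈1 i ⟩
    1#                                  ∎)
    where
    x^y^≈1 : ∀ k → x ^ k * y ^ k ≈ 1#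
    x^y^≈1 k = trans (sym (^-distrib-* x y k)) (trans (^-congˡ k xy≈1) (1^n≈1 k))
    xx^im≈1 : x * (x ^ i) ^ m ≈ 1#
    xx^im≈1 = begin
      x * (x ^ i) ^ m                   ≈⟨ *-congˡ (^-assocʳ x i m) ⟩
      x ^ (1 ℕ.+ i ℕ.* m)               ≡⟨ ≡.cong (λ d → x ^ (d ℕ.+ i ℕ.* m)) gcd≡1 ⟨
      x ^ (gcd m n ℕ.+ i ℕ.* m)         ≡⟨ ≡.cong (x ^_) eq ⟩
      x ^ (j ℕ.* n)                     ≈⟨ ^-*≈1 n j xⁿ≈1 ⟩
      1#                                ∎

  -- The list holds the coefficients below the leading one, constant term first.
  monic : List Carrier → Carrier → Carrier
  monic []       x = 1#
  monic (a ∷ as) x = a + x * monic as x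

  -- Synthetic division by X - r: the coefficients of the quotient are the intermediate values of
  -- Horner's scheme at r.
  monic-factor : ∀ a as r → ∃ λ bs → length bs ≡ length as ×
    (∀ x → monic (a ∷ as) x - monic (a ∷ as) r ≈ (x - r) * monic bs x)
  monic-factor a []        r = [] , ≡.refl , λ x →
    solve 3 (λ a x r → (a :+ x :* con 1ℤ) :- (a :+ r :* con 1ℤ) := (x :- r) :* con 1ℤ) refl a x r
  monic-factor a (a′ ∷ as) r with bs , |bs| , eq ← monic-factor a′ as r =
    monic (a′ ∷ as) r ∷ bs , ≡.cong suc |bs| , λ x → begin
    (a + x * monic (a′ ∷ as) x) - (a + r * monic (a′ ∷ as) r)
      ≈⟨ solve 5 (λ a x r h k → (a :+ x :* h) :- (a :+ r :* k) := (x :- r) :* k :+ x :* (h :- k)) refl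
           a x r (monic (a′ ∷ as) x) (monic (a′ ∷ as) r) ⟩
    (x - r) * monic (a′ ∷ as) r + x * (monic (a′ ∷ as) x - monic (a′ ∷ as) r)
      ≈⟨ +-congˡ (*-congˡ (eq x)) ⟩
    (x - r) * monic (a′ ∷ as) r + x * ((x - r) * monic bs x)
      ≈⟨ solve 4 (λ x d k g → d :* k :+ x :* (d :* g) := d :* (k :+ x :* g)) refl x (x - r) _ _ ⟩
    (x - r) * (monic (a′ ∷ as) r + x * monic bs x) ∎

  monic-roots : ∀ as {k} (f : Fin k → Carrier) →
    (∀ {i j} → f i ≈ f j → i ≡ j) → (∀ i → monic as (f i) ≈ 0#) → k ℕ.≤ length as
  monic-roots as       {zero}  f f-inj root = z≤n
  monic-roots []       {suc k} f f-inj root = contradiction (root zero) 1≉0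
  monic-roots (a ∷ as) {suc k} f f-inj root with bs , |bs| , eq ← monic-factor a as (f zero) =
    s≤s (≡.subst (k ℕ.≤_) |bs| (monic-roots bs (f ∘ suc) (Fin.suc-injective ∘ f-inj) root′))
    where
    root′ : ∀ i → monic bs (f (suc i)) ≈ 0#
    root′ i = *≈0 (≉⇒-≉0 λ e → contradiction (f-inj e) λ ()) (begin
      (f (suc i) - f zero) * monic bs (f (suc i))              ≈⟨ eq (f (suc i)) ⟨
      monic (a ∷ as) (f (suc i)) - monic (a ∷ as) (f zero)     ≈⟨ +-cong (root (suc i)) (-‿cong (root zero)) ⟩
      0# - 0#                                                  ≈⟨ -‿inverseʳ 0# ⟩
      0#                                                       ∎)

  monic-replicate : ∀ n x → monic (List.replicate n 0#) x ≈ x ^ n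
  monic-replicate zero    x = refl
  monic-replicate (suc n) x = trans (+-identityˡ _) (*-congˡ (monic-replicate n x))

  roots-of-unity-≤ : ∀ n → 0 ℕ.< n → ∀ {k} (f : Fin k → Carrier) →
    (∀ {i j} → f i ≈ f j → i ≡ j) → (∀ i → f i ^ n ≈ 1#) → k ℕ.≤ n
  roots-of-unity-≤ (suc n) _ {k} f f-inj root =
    ≡.subst (λ m → k ℕ.≤ suc m) (length-replicate n)
      (monic-roots (- 1# ∷ List.replicate n 0#) f f-inj λ i → begin
        - 1# + f i * monic (List.replicate n 0#) (f i) ≈⟨ +-congˡ (*-congˡ (monic-replicate n (f i))) ⟩
        - 1# + f i ^ suc n                        ≈⟨ +-congˡ (root i) ⟩
        - 1# + 1#                                 ≈⟨ -‿inverseˡ 1# ⟩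
        0#                                        ∎)

-- Counting in finite sets and finite fields

module FiniteSetoid {c ℓ} (S : Setoid c ℓ) {n} (enum : Bijection (≡.setoid (Fin n)) S) where
  open Setoid S
  open Bijection enum public using (to) renaming (injective to to-injective)

  from : Carrier → Fin n
  from x = proj₁ (Bijection.surjective enum x)

  to-from : ∀ x → to (from x) ≈ x
  to-from x = proj₂ (Bijection.surjective enum x) ≡.refl

  from-to : ∀ i → from (to i) ≡ i
  from-to i = to-injective (to-from (to i))

  from-cong : ∀ {x y} → x ≈ y → from x ≡ from y
  from-cong x≈y = to-injective (trans (to-from _) (trans x≈y (sym (to-from _))))

  from-injective : ∀ {x y} → from x ≡ from y → x ≈ y
  from-injective {x} {y} eq = trans (sym (to-from x)) (trans (reflexive (≡.cong to eq)) (to-from y))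

  infix 4 _≟_
  _≟_ : Decidable _≈_
  x ≟ y = map′ from-injective from-cong (from x Fin.≟ from y)

  -- If y were missed, adjoining it to the values of f would inject n + 1 elements into n.
  injective⇒surjective : ∀ {f} → Injective _≈_ _≈_ f → ∀ y → ∃ λ i → f (to i) ≈ y
  injective⇒surjective {f} f-inj y with Fin.any? (λ i → f (to i) ≟ y)
  ... | yes found = found
  ... | no ¬found = contradiction (Fin.injective⇒≤ g-inj) ℕ.1+n≰n
    where
    g : Fin (suc n) → Fin n
    g zero    = from y
    g (suc i) = from (f (to i))
    g-inj : Injective _≡_ _≡_ g
    g-inj {zero}  {zero}  eq = ≡.refl
    g-inj {zero}  {suc j} eq = contradiction (j , sym (from-injective eq)) ¬found
    g-inj {suc i} {zero}  eq = contradiction (i , from-injective eq) ¬found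
    g-inj {suc i} {suc j} eq = ≡.cong suc (to-injective (f-inj (from-injective eq)))

  module _ {c′ ℓ′} (M : CommutativeMonoid c′ ℓ′) where
    private module M = CommutativeMonoid M
    open import Algebra.Properties.CommutativeMonoid.Sum M using (sum; ∑-permute; sum-cong-≋)

    -- An injective self-map of a finite set is a permutation. Used additively for translation by 1
    -- and multiplicatively for multiplication by a unit.
    sum-reindex : ∀ {g f} → Congruent _≈_ M._≈_ g → Congruent _≈_ _≈_ f → Injective _≈_ _≈_ f →
      sum (g ∘ to) M.≈ sum (g ∘ f ∘ to)
    sum-reindex {g} {f} g-cong f-cong f-inj =
      M.trans (∑-permute (g ∘ to) π) (sum-cong-≋ λ i → g-cong (to-from (f (to i))))
      where
      f⁻¹ : Fin n → Fin n
      f⁻¹ j = proj₁ (injective⇒surjective f-inj (to j))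
      f-f⁻¹ : ∀ j → f (to (f⁻¹ j)) ≈ to j
      f-f⁻¹ j = proj₂ (injective⇒surjective f-inj (to j))
      π : Permutation n n
      π = permutation (from ∘ f ∘ to) f⁻¹
        (λ j → ≡.trans (from-cong (f-f⁻¹ j)) (from-to j))
        (λ i → to-injective (f-inj (trans (f-f⁻¹ _) (to-from (f (to i))))))

module FiniteField {c ℓ} (A : CommutativeRing c ℓ) (isDiscreteField : IsDiscreteField A)
  {m} (enum : Bijection (≡.setoid (Fin (suc m))) (CommutativeRing.setoid A)) where

  open CommutativeRing A renaming (zero to *-zero)
  open IsDiscreteField isDiscreteField
  open DiscreteField A isDiscreteField
  open FiniteSetoid setoid enum
  open import Algebra.Properties.CommutativeSemiring.Exp commutativeSemiring
  open import Algebra.Properties.Semiring.Mult semiring using () renaming (_×_ to _·_)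
  open import Algebra.Properties.AbelianGroup +-abelianGroup using (∙-cancelˡ; identityˡ-unique)
  open import Relation.Binary.Reasoning.Setoid setoid

  -- Translation by 1 permutes the field and so fixes the sum of all elements, while it adds 1 once
  -- per element.
  cardinality·1≈0 : suc m · 1# ≈ 0#
  cardinality·1≈0 = identityˡ-unique _ (sum to) (begin
    suc m · 1# + sum to                        ≈⟨ +-congʳ (sum-replicate (suc m)) ⟨
    sum (Vec.replicate (suc m) 1#) + sum to    ≈⟨ ∑-distrib-+ (Vec.replicate (suc m) 1#) to ⟨
    sum (λ i → 1# + to i)                      ≈⟨ sum-reindex +-commutativeMonoid (λ eq → eq) +-congˡ (∙-cancelˡ 1# _ _) ⟨
    sum to                                     ∎)
    where open import Algebra.Properties.CommutativeMonoid.Sum +-commutativeMonoid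

  nonzero : Fin m → Carrier
  nonzero i = to (punchIn (from 0#) i)

  nonzero≉0 : ∀ i → ¬ (nonzero i ≈ 0#)
  nonzero≉0 i eq = Fin.punchInᵢ≢i (from 0#) i (≡.trans (≡.sym (from-to _)) (from-cong eq))

  nonzero-injective : ∀ {i j} → nonzero i ≈ nonzero j → i ≡ j
  nonzero-injective eq = Fin.punchIn-injective (from 0#) _ _ (to-injective eq)

  -- Multiplication by x permutes the field, and it multiplies the product of the
  -- units, in which zero is replaced by 1, by one factor x for each unit.
  x^m≈1 : ∀ {x} → ¬ (x ≈ 0#) → x ^ m ≈ 1#
  x^m≈1 {x} x≉0 = *-cancelʳ (∏≉0 (λ i → unit≉0 (to i))) (begin
    x ^ m * ∏ (unit ∘ to)                          ≈⟨ *-congʳ ∏factor ⟨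
    ∏ (factor ∘ to) * ∏ (unit ∘ to)                ≈⟨ ∑-distrib-+ (factor ∘ to) (unit ∘ to) ⟨
    ∏ (λ i → factor (to i) * unit (to i))          ≈⟨ sum-cong-≋ (λ i → unit-* (to i)) ⟨
    ∏ (unit ∘ (x *_) ∘ to)                         ≈⟨ sum-reindex *-commutativeMonoid unit-cong *-congˡ (*-cancelˡ x≉0) ⟨
    ∏ (unit ∘ to)                                  ≈⟨ *-identityˡ _ ⟨
    1# * ∏ (unit ∘ to)                             ∎)
    where
    open import Algebra.Properties.CommutativeMonoid.Sum *-commutativeMonoid
      renaming (sum to ∏)
    unit factor : Carrier → Carrier
    unit y with y ≟ 0#
    ... | yes _ = 1#
    ... | no  _ = y
    factor y with y ≟ 0#
    ... | yes _ = 1#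
    ... | no  _ = x
    unit≉0 : ∀ y → ¬ (unit y ≈ 0#)
    unit≉0 y with y ≟ 0#
    ... | yes _  = 1≉0
    ... | no y≉0 = y≉0
    unit-cong : ∀ {y z} → y ≈ z → unit y ≈ unit z
    unit-cong {y} {z} y≈z with y ≟ 0# | z ≟ 0#
    ... | yes _   | yes _   = refl
    ... | yes y≈0 | no z≉0  = contradiction (trans (sym y≈z) y≈0) z≉0
    ... | no y≉0  | yes z≈0 = contradiction (trans y≈z z≈0) y≉0
    ... | no _    | no _    = y≈z
    unit-* : ∀ y → unit (x * y) ≈ factor y * unit y
    unit-* y with x * y ≟ 0# | y ≟ 0#
    ... | yes _    | yes _   = sym (*-identityˡ 1#)
    ... | yes xy≈0 | no y≉0  = contradiction xy≈0 (*≉0 x≉0 y≉0)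
    ... | no xy≉0  | yes y≈0 = contradiction (trans (*-congˡ y≈0) (zeroʳ x)) xy≉0
    ... | no _     | no _    = refl
    ∏≉0 : ∀ {n} {f : Fin n → Carrier} → (∀ i → ¬ (f i ≈ 0#)) → ¬ (∏ f ≈ 0#)
    ∏≉0 {zero}  f≉0 = 1≉0
    ∏≉0 {suc n} f≉0 = *≉0 (f≉0 zero) (∏≉0 (f≉0 ∘ suc))
    factor-zero : factor (to (from 0#)) ≈ 1#
    factor-zero with to (from 0#) ≟ 0#
    ... | yes _  = refl
    ... | no 0≉0 = contradiction (to-from 0#) 0≉0
    factor-nonzero : ∀ i → factor (nonzero i) ≈ x
    factor-nonzero i with nonzero i ≟ 0#
    ... | yes eq = contradiction eq (nonzero≉0 i)
    ... | no _   = refl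
    ∏factor : ∏ (factor ∘ to) ≈ x ^ m
    ∏factor = begin
      ∏ (factor ∘ to)
        ≈⟨ sum-remove {i = from 0#} (factor ∘ to) ⟩
      factor (to (from 0#)) * ∏ (factor ∘ nonzero)
        ≈⟨ *-cong factor-zero (trans (sum-cong-≋ factor-nonzero) (sum-replicate m)) ⟩
      1# * x ^ m
        ≈⟨ *-identityˡ _ ⟩
      x ^ m ∎

  x^1+m≈x : ∀ x → x ^ suc m ≈ x
  x^1+m≈x x with x ≟ 0#
  ... | yes x≈0 = trans (*-congʳ x≈0) (trans (zeroˡ _) (sym x≈0))
  ... | no  x≉0 = trans (*-congˡ (x^m≈1 x≉0)) (*-identityʳ x)

  -- Otherwise all m units would be roots of X^n - 1, which has at most n.
  ∃-power≉1 : ∀ {n} → 0 ℕ.< n → n ℕ.< m → ∃ λ x → ¬ (x ≈ 0#) × ¬ (x ^ n ≈ 1#)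
  ∃-power≉1 {n} 0<n n<m with Fin.any? (λ i → ¬? (nonzero i ^ n ≟ 1#))
  ... | yes (i , ne) = nonzero i , nonzero≉0 i , ne
  ... | no ¬found    = contradiction
    (roots-of-unity-≤ n 0<n nonzero nonzero-injective
      λ i → decidable-stable (nonzero i ^ n ≟ 1#) λ ne → ¬found (i , ne))
    (ℕ.<⇒≱ n<m)

  -- The power with exponent m / d of any unit is a d-th root of unity; since m / d < m, some unit
  -- has such a power different from 1.
  ∃-root-of-unity : ∀ {d} → 1 ℕ.< d → d ∣ m → 0 ℕ.< m → ∃ λ ζ → ¬ (ζ ≈ 1#) × ζ ^ d ≈ 1#
  ∃-root-of-unity {d} 1<d (divides zero    m≡0)    0<m = contradiction m≡0 (ℕ.>⇒≢ 0<m)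
  ∃-root-of-unity {d} 1<d (divides (suc k) m≡[1+k]d) 0<m
    with x , x≉0 , x^[1+k]≉1 ← ∃-power≉1 (s≤s z≤n)
           (≡.subst (suc k ℕ.<_) (≡.sym m≡[1+k]d) (ℕ.m<m*n (suc k) d 1<d))
    = x ^ suc k , x^[1+k]≉1 , (begin
      (x ^ suc k) ^ d     ≈⟨ ^-assocʳ x (suc k) d ⟩
      x ^ (suc k ℕ.* d)   ≡⟨ ≡.cong (x ^_) m≡[1+k]d ⟨
      x ^ m               ≈⟨ x^m≈1 x≉0 ⟩
      1#                  ∎)

-- The Frobenius map

[1+k]*[1+n]C[1+k]≡[1+n]*nCk : ∀ n k → suc k ℕ.* (suc n C suc k) ≡ suc n ℕ.* (n C k)
[1+k]*[1+n]C[1+k]≡[1+n]*nCk zero    zero    = ≡.refl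
[1+k]*[1+n]C[1+k]≡[1+n]*nCk zero    (suc k) = ≡.trans
  (≡.cong (suc (suc k) ℕ.*_) (k>n⇒nCk≡0 {1} {suc (suc k)} (s<s (s≤s z≤n))))
  (≡.trans (ℕ.*-zeroʳ (suc (suc k))) (≡.sym (≡.cong (1 ℕ.*_) (k>n⇒nCk≡0 {0} {suc k} (s≤s z≤n)))))
[1+k]*[1+n]C[1+k]≡[1+n]*nCk (suc n) zero    = begin
  1 ℕ.* (suc (suc n) C 1)            ≡⟨ ≡.cong (1 ℕ.*_) (nCk+nC[k+1]≡[n+1]C[k+1] (suc n) 0) ⟨
  1 ℕ.* (1 ℕ.+ (suc n C 1))          ≡⟨ lemma (suc n C 1) ⟩
  1 ℕ.+ 1 ℕ.* (suc n C 1)            ≡⟨ ≡.cong suc ([1+k]*[1+n]C[1+k]≡[1+n]*nCk n zero) ⟩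
  suc (suc n) ℕ.* (suc n C 0)        ∎
  where
  open ≡.≡-Reasoning
  lemma : ∀ c → 1 ℕ.* (1 ℕ.+ c) ≡ 1 ℕ.+ 1 ℕ.* c
  lemma = solve-∀
[1+k]*[1+n]C[1+k]≡[1+n]*nCk (suc n) (suc k) = begin
  (2 ℕ.+ k) ℕ.* (suc (suc n) C suc (suc k))
    ≡⟨ ≡.cong ((2 ℕ.+ k) ℕ.*_) (nCk+nC[k+1]≡[n+1]C[k+1] (suc n) (suc k)) ⟨
  (2 ℕ.+ k) ℕ.* ((suc n C suc k) ℕ.+ (suc n C suc (suc k)))
    ≡⟨ lemma₁ k (suc n C suc k) (suc n C suc (suc k)) ⟩
  (suc n C suc k) ℕ.+ (suc k ℕ.* (suc n C suc k) ℕ.+ (2 ℕ.+ k) ℕ.* (suc n C suc (suc k)))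
    ≡⟨ ≡.cong ((suc n C suc k) ℕ.+_) (≡.cong₂ ℕ._+_
         ([1+k]*[1+n]C[1+k]≡[1+n]*nCk n k) ([1+k]*[1+n]C[1+k]≡[1+n]*nCk n (suc k))) ⟩
  (suc n C suc k) ℕ.+ (suc n ℕ.* (n C k) ℕ.+ suc n ℕ.* (n C suc k))
    ≡⟨ ≡.cong ((suc n C suc k) ℕ.+_) (ℕ.*-distribˡ-+ (suc n) (n C k) (n C suc k)) ⟨
  (suc n C suc k) ℕ.+ suc n ℕ.* ((n C k) ℕ.+ (n C suc k))
    ≡⟨ ≡.cong (λ c → (suc n C suc k) ℕ.+ suc n ℕ.* c) (nCk+nC[k+1]≡[n+1]C[k+1] n k) ⟩
  suc (suc n) ℕ.* (suc n C suc k) ∎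
  where
  open ≡.≡-Reasoning
  lemma₁ : ∀ k a b → (2 ℕ.+ k) ℕ.* (a ℕ.+ b) ≡ a ℕ.+ (suc k ℕ.* a ℕ.+ (2 ℕ.+ k) ℕ.* b)
  lemma₁ = solve-∀

-- By the absorption identity p divides 1 + k times the binomial coefficient, and 1 + k is too small
-- to be a multiple of p.
prime∣pC[1+k] : ∀ {p k} → Prime p → suc k ℕ.< p → p ∣ p C suc k
prime∣pC[1+k] {zero}  {k} p-prime _     = contradiction p-prime ¬prime[0]
prime∣pC[1+k] {suc n} {k} p-prime 1+k<p
  with euclidsLemma (suc k) (suc n C suc k) p-prime
         (≡.subst (suc n ∣_) (≡.sym ([1+k]*[1+n]C[1+k]≡[1+n]*nCk n k)) (m∣m*n (n C k)))
... | inj₁ p∣1+k = contradiction (∣⇒≤ p∣1+k) (ℕ.<⇒≱ 1+k<p)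
... | inj₂ p∣C   = p∣C

module Frobenius {c ℓ} (A : CommutativeRing c ℓ) where
  open CommutativeRing A renaming (zero to *-zero)
  open import Algebra.Properties.CommutativeSemiring.Exp commutativeSemiring
  open import Algebra.Properties.Semiring.Mult semiring renaming (_×_ to _·_)
  open import Algebra.Properties.Monoid.Sum +-monoid using (sum; sum-init-last; sum-cong-≋; sum-replicate-zero)
  open import Algebra.Properties.CommutativeSemiring.Binomial commutativeSemiring as Binomial using (binomialTerm)
  open import Relation.Binary.Reasoning.Setoid setoid

  n·x≈0 : ∀ {p n} → p · 1# ≈ 0# → p ∣ n → ∀ x → n · x ≈ 0#
  n·x≈0 {p} p·1≈0 (divides k ≡.refl) x = begin
    (k ℕ.* p) · x                 ≈⟨ ×-congʳ (k ℕ.* p) (*-identityˡ x) ⟨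
    (k ℕ.* p) · (1# * x)          ≈⟨ ×-assoc-* (k ℕ.* p) 1# x ⟨
    (k ℕ.* p) · 1# * x            ≈⟨ *-congʳ (×1-homo-* k p) ⟩
    k · 1# * p · 1# * x           ≈⟨ *-congʳ (*-congˡ p·1≈0) ⟩
    k · 1# * 0# * x               ≈⟨ *-congʳ (zeroʳ _) ⟩
    0# * x                        ≈⟨ zeroˡ x ⟩
    0#                            ∎

  [x+y]^p≈x^p+y^p : ∀ {p} → Prime p → p · 1# ≈ 0# → ∀ x y → (x + y) ^ p ≈ x ^ p + y ^ p
  [x+y]^p≈x^p+y^p {zero}  p-prime p·1≈0 x y = contradiction p-prime ¬prime[0]
  [x+y]^p≈x^p+y^p {suc n} p-prime p·1≈0 x y = begin
    (x + y) ^ suc n                                            ≈⟨ Binomial.theorem (suc n) x y ⟩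
    term zero + sum (tail term)                                ≈⟨ +-congˡ (sum-init-last (tail term)) ⟩
    term zero + (sum (init (tail term)) + term (fromℕ (suc n)))
      ≈⟨ +-cong (trans (+-identityʳ _) (*-identityˡ _))
           (+-cong (trans (sum-cong-≋ middle) (sum-replicate-zero n)) final) ⟩
    y ^ suc n + (0# + x ^ suc n)                               ≈⟨ +-congˡ (+-identityˡ _) ⟩
    y ^ suc n + x ^ suc n                                      ≈⟨ +-comm _ _ ⟩
    x ^ suc n + y ^ suc n                                      ∎
    where
    term : Fin (suc (suc n)) → Carrier
    term = binomialTerm x y (suc n)
    middle : ∀ i → init (tail term) i ≈ 0#
    middle i = n·x≈0 p·1≈0 (prime∣pC[1+k] p-prime
      (s<s (≡.subst (ℕ._< n) (≡.sym (toℕ-inject₁ i)) (toℕ<n i)))) _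
    final : term (fromℕ (suc n)) ≈ x ^ suc n
    final = begin
      (suc n C suc (toℕ (fromℕ n))) · (x ^ suc (toℕ (fromℕ n)) * y ^ (n ℕ.∸ toℕ (fromℕ n)))
        ≡⟨ ≡.cong (λ k → (suc n C suc k) · (x ^ suc k * y ^ (n ℕ.∸ k))) (toℕ-fromℕ n) ⟩
      (suc n C suc n) · (x ^ suc n * y ^ (n ℕ.∸ n))
        ≡⟨ ≡.cong₂ (λ a b → a · (x ^ suc n * y ^ b)) (nCn≡1 (suc n)) (ℕ.n∸n≡0 n) ⟩
      1 · (x ^ suc n * 1#)   ≈⟨ +-identityʳ _ ⟩
      x ^ suc n * 1#         ≈⟨ *-identityʳ _ ⟩
      x ^ suc n              ∎

  module _ {p} (p-prime : Prime p) (p·1≈0 : p · 1# ≈ 0#) where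

    ^p^i-distrib-+ : ∀ i x y → (x + y) ^ (p ℕ.^ i) ≈ x ^ (p ℕ.^ i) + y ^ (p ℕ.^ i)
    ^p^i-distrib-+ zero    x y = trans (*-identityʳ _) (sym (+-cong (*-identityʳ x) (*-identityʳ y)))
    ^p^i-distrib-+ (suc i) x y = begin
      (x + y) ^ (p ℕ.* p ℕ.^ i)                           ≈⟨ ^-assocʳ (x + y) p (p ℕ.^ i) ⟨
      ((x + y) ^ p) ^ (p ℕ.^ i)                           ≈⟨ ^-congˡ (p ℕ.^ i) ([x+y]^p≈x^p+y^p p-prime p·1≈0 x y) ⟩
      (x ^ p + y ^ p) ^ (p ℕ.^ i)                         ≈⟨ ^p^i-distrib-+ i (x ^ p) (y ^ p) ⟩
      (x ^ p) ^ (p ℕ.^ i) + (y ^ p) ^ (p ℕ.^ i)           ≈⟨ +-cong (^-assocʳ x p (p ℕ.^ i)) (^-assocʳ y p (p ℕ.^ i)) ⟩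
      x ^ (p ℕ.* p ℕ.^ i) + y ^ (p ℕ.* p ℕ.^ i)           ∎

-- Permutations of a quadratic extension

module AdditivePower {c ℓ} (A : CommutativeRing c ℓ) (n : ℕ)
  (^-distrib-+ : Powers.AdditiveExponent A (suc n)) where
  open CommutativeRing A
  open import Algebra.Properties.CommutativeSemiring.Exp commutativeSemiring
  open import Algebra.Properties.AbelianGroup +-abelianGroup using (inverseʳ-unique)
  open import Relation.Binary.Reasoning.Setoid setoid

  -- Derived from additivity, which avoids a distinction by the parity of the exponent and by
  -- characteristic 2.
  ^-neg : ∀ x → (- x) ^ suc n ≈ - (x ^ suc n)
  ^-neg x = inverseʳ-unique _ _ (begin
    x ^ suc n + (- x) ^ suc n     ≈⟨ ^-distrib-+ x (- x) ⟨
    (x - x) ^ suc n               ≈⟨ ^-congˡ (suc n) (-‿inverseʳ x) ⟩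
    0# * 0# ^ n                   ≈⟨ zeroˡ _ ⟩
    0#                            ∎)

  ^-distrib-- : ∀ x y → (x - y) ^ suc n ≈ x ^ suc n - y ^ suc n
  ^-distrib-- x y = trans (^-distrib-+ x (- y)) (+-congˡ (^-neg y))

-- The cardinality q² is written as 1 + (q - 1)(q + 1), which exhibits the order of the unit group
-- and its divisors q - 1 and q + 1. That q is a power of the characteristic enters as additivity of
-- the q-th power.
module QuadraticExtension {c ℓ} (A : CommutativeRing c ℓ) (isDiscreteField : IsDiscreteField A)
  (q-1 : ℕ) (0<q-1 : 0 ℕ.< q-1)
  (enum : Bijection (≡.setoid (Fin (suc (q-1 ℕ.* suc (suc q-1))))) (CommutativeRing.setoid A))
  (^q-distrib-+ : Powers.AdditiveExponent A (suc q-1))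
  where

  open CommutativeRing A renaming (zero to *-zero)
  open IsDiscreteField isDiscreteField
  open IntegerCoefficients A
  open DiscreteField A isDiscreteField
  open Powers A
  open FiniteSetoid setoid enum
  open FiniteField A isDiscreteField enum
  open AdditivePower A q-1 ^q-distrib-+
  open import Algebra.Properties.CommutativeSemiring.Exp commutativeSemiring
  open import Algebra.Properties.AbelianGroup +-abelianGroup using (inverseʳ-unique)
  open import Relation.Binary.Reasoning.Setoid setoid

  q : ℕ
  q = suc q-1

  μ : Carrier → Set ℓ
  μ x = x ^ suc q ≈ 1#

  0<[q-1]*[q+1] : 0 ℕ.< q-1 ℕ.* suc q
  0<[q-1]*[q+1] = ℕ.≤-trans 0<q-1 (ℕ.m≤m*n q-1 (suc q))

  μ-^q-1 : ∀ {u} → ¬ (u ≈ 0#) → μ (u ^ q-1)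
  μ-^q-1 {u} u≉0 = trans (^-assocʳ u q-1 (suc q)) (x^m≈1 u≉0)

  μ-1 : μ 1#
  μ-1 = 1^n≈1 (suc q)

  x^q^q≈x : ∀ x → (x ^ q) ^ q ≈ x
  x^q^q≈x x = begin
    (x ^ q) ^ q                      ≈⟨ ^-assocʳ x q q ⟩
    x ^ (q ℕ.* q)                    ≡⟨ ≡.cong (x ^_) (q² q-1) ⟩
    x ^ suc (q-1 ℕ.* suc (suc q-1))  ≈⟨ x^1+m≈x x ⟩
    x                                ∎
    where
    q² : ∀ k → suc k ℕ.* suc k ≡ suc (k ℕ.* suc (suc k))
    q² = solve-∀

  -- 1 + y ^ q is a solution unless y = -1, in which case t - t ^ q is one for any
  -- t outside of the fixed field.
  hilbert90 : ∀ {y} → μ y → ∃ λ u → ¬ (u ≈ 0#) × u ^ q-1 ≈ y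
  hilbert90 {y} y∈μ with y ≟ - 1#
  ... | no y≉-1 = u , u≉0 , *-cancelˡ u≉0 (begin
    (1# + y ^ q) ^ q        ≈⟨ ^q-distrib-+ 1# (y ^ q) ⟩
    1# ^ q + (y ^ q) ^ q    ≈⟨ +-cong (1^n≈1 q) (x^q^q≈x y) ⟩
    1# + y                  ≈⟨ uy≈1+y ⟨
    u * y                   ∎)
    where
    u : Carrier
    u = 1# + y ^ q
    uy≈1+y : u * y ≈ 1# + y
    uy≈1+y = begin
      (1# + y ^ q) * y      ≈⟨ solve 2 (λ y z → (con 1ℤ :+ z) :* y := y :* z :+ y) refl y (y ^ q) ⟩
      y * y ^ q + y         ≈⟨ +-congʳ y∈μ ⟩
      1# + y                ∎
    u≉0 : ¬ (u ≈ 0#)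
    u≉0 u≈0 = y≉-1 (inverseʳ-unique 1# y (trans (sym uy≈1+y) (trans (*-congʳ u≈0) (zeroˡ y))))
  ... | yes y≈-1 with t , t≉0 , t^≉1 ← ∃-power≉1 0<q-1 (ℕ.m<m*n q-1 (suc q) {{ℕ.>-nonZero 0<q-1}} (s<s (s≤s z≤n))) =
    u , u≉0 , *-cancelˡ u≉0 (begin
    (t - t ^ q) ^ q         ≈⟨ ^-distrib-- t (t ^ q) ⟩
    t ^ q - (t ^ q) ^ q     ≈⟨ +-congˡ (-‿cong (x^q^q≈x t)) ⟩
    t ^ q - t               ≈⟨ solve 2 (λ t s → s :- t := (t :- s) :* :- con 1ℤ) refl t (t ^ q) ⟩
    u * - 1#                ≈⟨ *-congˡ y≈-1 ⟨
    u * y                   ∎)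
    where
    u : Carrier
    u = t - t ^ q
    u≉0 : ¬ (u ≈ 0#)
    u≉0 = ≉⇒-≉0 λ t≈t^q → t^≉1 (*-cancelˡ t≉0 (trans (sym t≈t^q) (sym (*-identityʳ t))))

  -- Here l is a number such that x ↦ d x / c x is conjugate to the n-th power map on
  -- a set on which that map is injective iff gcd n l ≡ 1.  Values of d / c are only
  -- compared after cross-multiplication.
  module PermutationCriterion
    (n l r : ℕ) (0<r : 0 ℕ.< r) (r≡n : r % suc q ≡ n % suc q)
    (c d : Carrier → Carrier) (c-cong : Congruent _≈_ _≈_ c) (d-cong : Congruent _≈_ _≈_ d)
    (κ : Carrier) (κ≉0 : ¬ (κ ≈ 0#))
    (c≉0 : ∀ {x} → μ x → ¬ (c x ≈ 0#))
    (conjugate : ∀ {x} → μ x → x ^ n * c x ^ q ≈ κ * d x)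
    (separates : gcd n l ≡ 1 → ∀ {x y} → μ x → μ y → d x * c y ≈ d y * c x → x ≈ y)
    (collides : ¬ (gcd n l ≡ 1) → ∃ λ x → μ x × ¬ (x ≈ 1#) × d x * c 1# ≈ d 1# * c x)
    where

    h : Carrier → Carrier
    h u = u ^ r * c (u ^ q-1)

    -- The factor `c (u ^ q-1)` completes the (q-1)-th power of c to a q-th power, and r may be
    -- replaced by n because x = u^(q-1) satisfies x^(q+1) = 1. So h(u)^(q-1) is the value of κ d /
    -- c at x.
    h-^q-1 : ∀ {u} → ¬ (u ≈ 0#) → h u ^ q-1 * c (u ^ q-1) ≈ κ * d (u ^ q-1)
    h-^q-1 {u} u≉0 = begin
      (u ^ r * c x) ^ q-1 * c x            ≈⟨ *-congʳ (^-distrib-* (u ^ r) (c x) q-1) ⟩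
      (u ^ r) ^ q-1 * c x ^ q-1 * c x      ≈⟨ solve 3 (λ a b c → a :* b :* c := a :* (c :* b)) refl ((u ^ r) ^ q-1) (c x ^ q-1) (c x) ⟩
      (u ^ r) ^ q-1 * c x ^ q              ≈⟨ *-congʳ (^-comm u r q-1) ⟩
      x ^ r * c x ^ q                      ≈⟨ *-congʳ (^-cong-% r n q (μ-^q-1 u≉0) r≡n) ⟩
      x ^ n * c x ^ q                      ≈⟨ conjugate (μ-^q-1 u≉0) ⟩
      κ * d x                              ∎
      where
      x : Carrier
      x = u ^ q-1

    c≉0′ : ∀ {u} → ¬ (u ≈ 0#) → ¬ (c (u ^ q-1) ≈ 0#)
    c≉0′ u≉0 = c≉0 (μ-^q-1 u≉0)

    h≉0 : ∀ {u} → ¬ (u ≈ 0#) → ¬ (h u ≈ 0#)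
    h≉0 u≉0 = *≉0 (^≉0 r u≉0) (c≉0′ u≉0)

    h-0 : ∀ {u} → u ≈ 0# → h u ≈ 0#
    h-0 u≈0 = trans (*-congʳ (≈0⇒^≈0 0<r u≈0)) (zeroˡ _)

    cross : ∀ {u v} → ¬ (u ≈ 0#) → ¬ (v ≈ 0#) → h u ^ q-1 ≈ h v ^ q-1 →
      d (u ^ q-1) * c (v ^ q-1) ≈ d (v ^ q-1) * c (u ^ q-1)
    cross {u} {v} u≉0 v≉0 eq = *-cancelˡ κ≉0 (begin
      κ * (d x * c y)             ≈⟨ *-assoc κ _ _ ⟨
      κ * d x * c y               ≈⟨ *-congʳ (h-^q-1 u≉0) ⟨
      h u ^ q-1 * c x * c y       ≈⟨ *-congʳ (*-congʳ eq) ⟩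
      h v ^ q-1 * c x * c y       ≈⟨ solve 3 (λ a b c → a :* b :* c := a :* c :* b) refl (h v ^ q-1) (c x) (c y) ⟩
      h v ^ q-1 * c y * c x       ≈⟨ *-congʳ (h-^q-1 v≉0) ⟩
      κ * d y * c x               ≈⟨ *-assoc κ _ _ ⟩
      κ * (d y * c x)             ∎)
      where
      x y : Carrier
      x = u ^ q-1
      y = v ^ q-1

    uncross : ∀ {u v} → ¬ (u ≈ 0#) → ¬ (v ≈ 0#) →
      d (u ^ q-1) * c (v ^ q-1) ≈ d (v ^ q-1) * c (u ^ q-1) → h u ^ q-1 ≈ h v ^ q-1
    uncross {u} {v} u≉0 v≉0 eq = *-cancelʳ (*≉0 (c≉0′ u≉0) (c≉0′ v≉0)) (begin
      h u ^ q-1 * (c x * c y)     ≈⟨ *-assoc _ _ _ ⟨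
      h u ^ q-1 * c x * c y       ≈⟨ *-congʳ (h-^q-1 u≉0) ⟩
      κ * d x * c y               ≈⟨ *-assoc κ _ _ ⟩
      κ * (d x * c y)             ≈⟨ *-congˡ eq ⟩
      κ * (d y * c x)             ≈⟨ *-assoc κ _ _ ⟨
      κ * d y * c x               ≈⟨ *-congʳ (h-^q-1 v≉0) ⟨
      h v ^ q-1 * c y * c x       ≈⟨ solve 3 (λ a b c → a :* c :* b := a :* (b :* c)) refl (h v ^ q-1) (c x) (c y) ⟩
      h v ^ q-1 * (c x * c y)     ∎)
      where
      x y : Carrier
      x = u ^ q-1
      y = v ^ q-1

    -- The (q-1)-th powers of the values determine u^(q-1). Cancelling c then leaves u^r, and u^r
    -- and u^(q-1) together determine u.
    h-injective : gcd r q-1 ≡ 1 → gcd n l ≡ 1 → Injective _≈_ _≈_ h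
    h-injective gcd[r,q-1]≡1 gcd[n,l]≡1 {u} {v} hu≈hv with u ≟ 0# | v ≟ 0#
    ... | yes u≈0 | yes v≈0 = trans u≈0 (sym v≈0)
    ... | yes u≈0 | no  v≉0 = contradiction (trans (sym hu≈hv) (h-0 u≈0)) (h≉0 v≉0)
    ... | no  u≉0 | yes v≈0 = contradiction (trans hu≈hv (h-0 v≈0)) (h≉0 u≉0)
    ... | no  u≉0 | no  v≉0 = coprime-powers-injective r q-1 gcd[r,q-1]≡1 v≉0 uʳ≈vʳ x≈y
      where
      x≈y : u ^ q-1 ≈ v ^ q-1
      x≈y = separates gcd[n,l]≡1 (μ-^q-1 u≉0) (μ-^q-1 v≉0) (cross u≉0 v≉0 (^-congˡ q-1 hu≈hv))
      uʳ≈vʳ : u ^ r ≈ v ^ r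
      uʳ≈vʳ = *-cancelʳ (c≉0′ v≉0) (trans (*-congˡ (c-cong (sym x≈y))) hu≈hv)

    h-root-of-unity : ∀ {ζ} → ζ ^ q-1 ≈ 1# → h ζ ≈ ζ ^ r * c 1#
    h-root-of-unity ζ^≈1 = *-congˡ (c-cong ζ^≈1)

    h-1 : h 1# ≈ c 1#
    h-1 = trans (h-root-of-unity (1^n≈1 q-1)) (trans (*-congʳ (1^n≈1 r)) (*-identityˡ _))

    h-injective⇒coprimeʳ : Injective _≈_ _≈_ h → gcd r q-1 ≡ 1
    h-injective⇒coprimeʳ h-inj with gcd r q-1 ℕ.≟ 1
    ... | yes ≡1 = ≡1
    ... | no  ≢1 with ζ , ζ≉1 , ζ^≈1 ← ∃-root-of-unity (gcd≢1⇒1<gcd 0<r ≢1)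
                        (∣-trans (gcd[m,n]∣n r q-1) (m∣m*n (suc q))) 0<[q-1]*[q+1] =
      contradiction (h-inj (begin
        h ζ             ≈⟨ h-root-of-unity (^-∣≈1 (gcd[m,n]∣n r q-1) ζ^≈1) ⟩
        ζ ^ r * c 1#    ≈⟨ *-congʳ (^-∣≈1 (gcd[m,n]∣m r q-1) ζ^≈1) ⟩
        1# * c 1#       ≈⟨ *-identityˡ _ ⟩
        c 1#            ≈⟨ h-1 ⟨
        h 1#            ∎)) ζ≉1

    -- The values at (q-1)-th roots of unity y are y^r c(1); for r coprime to q - 1 they exhaust the
    -- elements whose (q-1)-th power is that of h(1).
    h-onto-coset : gcd r q-1 ≡ 1 → ∀ {z} → ¬ (z ≈ 0#) → z ^ q-1 ≈ h 1# ^ q-1 →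
      ∃ λ y → y ^ q-1 ≈ 1# × h y ≈ z
    h-onto-coset gcd[r,q-1]≡1 {z} z≉0 z^≈h1^ =
      proj₁ root , proj₂ (proj₂ root) , (begin
        h y                   ≈⟨ h-root-of-unity (proj₂ (proj₂ root)) ⟩
        y ^ r * c 1#          ≈⟨ *-congʳ (proj₁ (proj₂ root)) ⟩
        z * c1⁻¹ * c 1#       ≈⟨ *-assoc z c1⁻¹ (c 1#) ⟩
        z * (c1⁻¹ * c 1#)     ≈⟨ *-congˡ (trans (*-comm c1⁻¹ (c 1#)) c1*c1⁻¹≈1) ⟩
        z * 1#                ≈⟨ *-identityʳ z ⟩
        z                     ∎)
      where
      c1⁻¹ : Carrier
      c1⁻¹ = proj₁ (inverse (c≉0 μ-1))
      c1*c1⁻¹≈1 : c 1# * c1⁻¹ ≈ 1#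
      c1*c1⁻¹≈1 = proj₂ (inverse (c≉0 μ-1))
      c1⁻¹≉0 : ¬ (c1⁻¹ ≈ 0#)
      c1⁻¹≉0 c1⁻¹≈0 = 1≉0 (trans (sym c1*c1⁻¹≈1) (trans (*-congˡ c1⁻¹≈0) (zeroʳ _)))
      root : ∃ λ y → y ^ r ≈ z * c1⁻¹ × y ^ q-1 ≈ 1#
      root = coprime-root r q-1 gcd[r,q-1]≡1 (*≉0 z≉0 c1⁻¹≉0) (begin
        (z * c1⁻¹) ^ q-1          ≈⟨ ^-distrib-* z c1⁻¹ q-1 ⟩
        z ^ q-1 * c1⁻¹ ^ q-1      ≈⟨ *-congʳ z^≈h1^ ⟩
        h 1# ^ q-1 * c1⁻¹ ^ q-1   ≈⟨ ^-distrib-* (h 1#) c1⁻¹ q-1 ⟨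
        (h 1# * c1⁻¹) ^ q-1       ≈⟨ ^-congˡ q-1 (trans (*-congʳ h-1) c1*c1⁻¹≈1) ⟩
        1# ^ q-1                  ≈⟨ 1^n≈1 q-1 ⟩
        1#                        ∎)
      y : Carrier
      y = proj₁ root

    -- Equal values of d / c at u^(q-1) and at 1 put h(u) among the values that h takes on (q-1)-th
    -- roots of unity; injectivity makes u one of these roots.
    h-injective⇒^q-1≈1 : Injective _≈_ _≈_ h → ∀ {u} → ¬ (u ≈ 0#) →
      d (u ^ q-1) * c 1# ≈ d 1# * c (u ^ q-1) → u ^ q-1 ≈ 1#
    h-injective⇒^q-1≈1 h-inj {u} u≉0 eq =
      trans (^-congˡ q-1 (h-inj (sym (proj₂ (proj₂ same)))) ) (proj₁ (proj₂ same))
      where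
      same : ∃ λ y → y ^ q-1 ≈ 1# × h y ≈ h u
      same = h-onto-coset (h-injective⇒coprimeʳ h-inj) (h≉0 u≉0) (uncross u≉0 1≉0 (begin
        d (u ^ q-1) * c (1# ^ q-1)   ≈⟨ *-congˡ (c-cong (1^n≈1 q-1)) ⟩
        d (u ^ q-1) * c 1#           ≈⟨ eq ⟩
        d 1# * c (u ^ q-1)           ≈⟨ *-congʳ (d-cong (1^n≈1 q-1)) ⟨
        d (1# ^ q-1) * c (u ^ q-1)   ∎))

    h-injective⇒coprimeˡ : Injective _≈_ _≈_ h → gcd n l ≡ 1
    h-injective⇒coprimeˡ h-inj = decidable-stable (gcd n l ℕ.≟ 1) λ ≢1 →
      refute (collides ≢1)
      where
      refute : ¬ (∃ λ x → μ x × ¬ (x ≈ 1#) × d x * c 1# ≈ d 1# * c x)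
      refute (x , x∈μ , x≉1 , eq) with u , u≉0 , u^≈x ← hilbert90 x∈μ =
        x≉1 (trans (sym u^≈x) (h-injective⇒^q-1≈1 h-inj u≉0 (begin
          d (u ^ q-1) * c 1#   ≈⟨ *-congʳ (d-cong u^≈x) ⟩
          d x * c 1#           ≈⟨ eq ⟩
          d 1# * c x           ≈⟨ *-congˡ (c-cong u^≈x) ⟨
          d 1# * c (u ^ q-1)   ∎)))

    h-injective⇔ : Injective _≈_ _≈_ h ⇔ (gcd r q-1 ≡ 1 × gcd n l ≡ 1)
    h-injective⇔ = mk⇔ {A = Injective _≈_ _≈_ h}
      (λ h-inj → h-injective⇒coprimeʳ h-inj , h-injective⇒coprimeˡ h-inj)
      (λ (gcd[r,q-1]≡1 , gcd[n,l]≡1) → h-injective gcd[r,q-1]≡1 gcd[n,l]≡1)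

-- Conjugates of power maps by a degree-one function

record IsPrimitiveCubeRoot {c ℓ} (A : CommutativeRing c ℓ) (ω : CommutativeRing.Carrier A) : Set ℓ where
  open CommutativeRing A
  field
    ω³≈1 : ω * ω * ω ≈ 1#
    ω≉1  : ¬ (ω ≈ 1#)

module CubeRoot {c ℓ} (A : CommutativeRing c ℓ) (isDiscreteField : IsDiscreteField A)
  (ω : CommutativeRing.Carrier A) (isPrimitiveCubeRoot : IsPrimitiveCubeRoot A ω) where
  open CommutativeRing A renaming (zero to *-zero)
  open IsPrimitiveCubeRoot isPrimitiveCubeRoot
  open IsDiscreteField isDiscreteField
  open DiscreteField A isDiscreteField
  open Powers A
  open import Algebra.Properties.CommutativeSemiring.Exp commutativeSemiring
  open import Relation.Binary.Reasoning.Setoid setoid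

  ω^3≈1 : ω ^ 3 ≈ 1#
  ω^3≈1 = trans (sym (*-assoc _ _ _)) (trans (*-congˡ (*-identityʳ ω)) ω³≈1)

  ω≉0 : ¬ (ω ≈ 0#)
  ω≉0 ω≈0 = 1≉0 (trans (sym ω³≈1) (trans (*-congˡ ω≈0) (zeroʳ _)))

  ω²≉1 : ¬ (ω * ω ≈ 1#)
  ω²≉1 ω²≈1 = ω≉1 (trans (sym (*-identityˡ ω)) (trans (*-congʳ (sym ω²≈1)) ω³≈1))

  ω^-cong : ∀ {m n} → m ≡₃ n → ω ^ m ≈ ω ^ n
  ω^-cong {m} {n} (mod₃ eq) = Powers.^-cong-% A m n 2 ω^3≈1 eq

  ω^-injective-< : ∀ {i j} → i ℕ.< 3 → j ℕ.< 3 → ω ^ i ≈ ω ^ j → i ≡ j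
  ω^-injective-< {0} {0} _ _ _ = ≡.refl
  ω^-injective-< {1} {1} _ _ _ = ≡.refl
  ω^-injective-< {2} {2} _ _ _ = ≡.refl
  ω^-injective-< {0} {1} _ _ eq = contradiction (sym (trans eq (*-identityʳ ω))) ω≉1
  ω^-injective-< {1} {0} _ _ eq = contradiction (trans (sym (*-identityʳ ω)) eq) ω≉1
  ω^-injective-< {0} {2} _ _ eq = contradiction (sym (trans eq (*-congˡ (*-identityʳ ω)))) ω²≉1
  ω^-injective-< {2} {0} _ _ eq = contradiction (trans (*-congˡ (sym (*-identityʳ ω))) eq) ω²≉1
  ω^-injective-< {1} {2} _ _ eq = contradiction (sym (trans (*-cancelˡ ω≉0 eq) (*-identityʳ ω))) ω≉1
  ω^-injective-< {2} {1} _ _ eq = contradiction (trans (sym (*-identityʳ ω)) (*-cancelˡ ω≉0 eq)) ω≉1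
  ω^-injective-< {suc (suc (suc _))} (s≤s (s≤s (s≤s ()))) _ _
  ω^-injective-< {_} {suc (suc (suc _))} _ (s≤s (s≤s (s≤s ()))) _

  ω^-% : ∀ m → ω ^ (m % 3) ≈ ω ^ m
  ω^-% m = begin
    ω ^ (m % 3)                       ≈⟨ ^-+* 3 (m % 3) (m / 3) ω^3≈1 ⟨
    ω ^ (m % 3 ℕ.+ m / 3 ℕ.* 3)       ≡⟨ ≡.cong (ω ^_) (m≡m%n+[m/n]*n m 3) ⟨
    ω ^ m                             ∎

  ω^-injective : ∀ {m n} → ω ^ m ≈ ω ^ n → m ≡₃ n
  ω^-injective {m} {n} eq = mod₃ (ω^-injective-< (m%n<n m 3) (m%n<n n 3) (trans (ω^-% m) (trans eq (sym (ω^-% n)))))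

module RedeiForms {c ℓ} (A : CommutativeRing c ℓ) (ω : CommutativeRing.Carrier A) (n : ℕ) where
  open CommutativeRing A
  open import Algebra.Properties.CommutativeSemiring.Exp commutativeSemiring

  a b c₁ c₂ : Carrier → Carrier
  a x  = x + ω
  b x  = ω * x + 1#
  c₁ x = b x ^ n - ω * a x ^ n
  c₂ x = a x ^ n - ω * b x ^ n

  a-cong : Congruent _≈_ _≈_ a
  a-cong = +-congʳ

  b-cong : Congruent _≈_ _≈_ b
  b-cong x≈y = +-congʳ (*-congˡ x≈y)

  c₁-cong : Congruent _≈_ _≈_ c₁
  c₁-cong x≈y = +-cong (^-congˡ n (b-cong x≈y)) (-‿cong (*-congˡ (^-congˡ n (a-cong x≈y))))

  c₂-cong : Congruent _≈_ _≈_ c₂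
  c₂-cong x≈y = +-cong (^-congˡ n (a-cong x≈y)) (-‿cong (*-congˡ (^-congˡ n (b-cong x≈y))))

module RedeiPermutations {c ℓ} (A : CommutativeRing c ℓ) (isDiscreteField : IsDiscreteField A)
  (q-1 : ℕ) (0<q-1 : 0 ℕ.< q-1)
  (enum : Bijection (≡.setoid (Fin (suc (q-1 ℕ.* suc (suc q-1))))) (CommutativeRing.setoid A))
  (^q-distrib-+ : Powers.AdditiveExponent A (suc q-1))
  (ω : CommutativeRing.Carrier A)
  (isPrimitiveCubeRoot : IsPrimitiveCubeRoot A ω)
  (n : ℕ) (0<n : 0 ℕ.< n)
  where

  open CommutativeRing A renaming (zero to *-zero)
  open IsDiscreteField isDiscreteField
  open IntegerCoefficients A
  open DiscreteField A isDiscreteField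
  open Powers A
  open FiniteSetoid setoid enum
  open FiniteField A isDiscreteField enum
  open AdditivePower A q-1 ^q-distrib-+
  open QuadraticExtension A isDiscreteField q-1 0<q-1 enum ^q-distrib-+
  open RedeiForms A ω n
  open IsPrimitiveCubeRoot isPrimitiveCubeRoot
  open CubeRoot A isDiscreteField ω isPrimitiveCubeRoot using (ω≉0; ω²≉1)
  open import Algebra.Properties.CommutativeSemiring.Exp commutativeSemiring
  open import Algebra.Properties.AbelianGroup +-abelianGroup using (x∙y⁻¹≈ε⇒x≈y; x≈y⇒x∙y⁻¹≈ε)
  open import Relation.Binary.Reasoning.Setoid setoid

  1-ω²≉0 : ¬ (1# - ω * ω ≈ 0#)
  1-ω²≉0 = ≉⇒-≉0 λ eq → ω²≉1 (sym eq)

  1+ω≉0 : ¬ (1# + ω ≈ 0#)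
  1+ω≉0 eq = 1-ω²≉0 (begin
    1# - ω * ω            ≈⟨ solve 1 (λ w → con 1ℤ :- w :* w := (con 1ℤ :+ w) :* (con 1ℤ :- w)) refl ω ⟩
    (1# + ω) * (1# - ω)   ≈⟨ *-congʳ eq ⟩
    0# * (1# - ω)         ≈⟨ zeroˡ _ ⟩
    0#                    ∎)

  μ⇒≉0 : ∀ {x} → μ x → ¬ (x ≈ 0#)
  μ⇒≉0 x∈μ x≈0 = 1≉0 (trans (sym x∈μ) (trans (*-congʳ x≈0) (zeroˡ _)))

  -- Reduces the conjugation formulas to the values u^q x and v^q x, by spreading the factor x^n
  -- over both summands.
  ^q-form : ∀ u v x → x ^ n * (u ^ n - ω * v ^ n) ^ q ≈ (u ^ q * x) ^ n - ω ^ q * (v ^ q * x) ^ n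
  ^q-form u v x = begin
    x ^ n * (u ^ n - ω * v ^ n) ^ q
      ≈⟨ *-congˡ (^-distrib-- (u ^ n) (ω * v ^ n)) ⟩
    x ^ n * ((u ^ n) ^ q - (ω * v ^ n) ^ q)
      ≈⟨ *-congˡ (+-cong (^-comm u n q) (-‿cong (trans (^-distrib-* ω (v ^ n) q) (*-congˡ (^-comm v n q))))) ⟩
    x ^ n * ((u ^ q) ^ n - ω ^ q * (v ^ q) ^ n)
      ≈⟨ solve 4 (λ x u w v → x :* (u :- w :* v) := u :* x :- w :* (v :* x)) refl
           (x ^ n) ((u ^ q) ^ n) (ω ^ q) ((v ^ q) ^ n) ⟩
    (u ^ q) ^ n * x ^ n - ω ^ q * ((v ^ q) ^ n * x ^ n)
      ≈⟨ +-cong (^-distrib-* (u ^ q) x n) (-‿cong (*-congˡ (^-distrib-* (v ^ q) x n))) ⟨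
    (u ^ q * x) ^ n - ω ^ q * (v ^ q * x) ^ n ∎

  -- On μ the q-th power of x is its inverse, and the factor x clears that denominator.
  a^q*x : ∀ {x} → μ x → a x ^ q * x ≈ 1# + ω ^ q * x
  a^q*x {x} x∈μ = begin
    (x + ω) ^ q * x           ≈⟨ *-congʳ (^q-distrib-+ x ω) ⟩
    (x ^ q + ω ^ q) * x       ≈⟨ solve 3 (λ x y w → (y :+ w) :* x := x :* y :+ w :* x) refl x (x ^ q) (ω ^ q) ⟩
    x * x ^ q + ω ^ q * x     ≈⟨ +-congʳ x∈μ ⟩
    1# + ω ^ q * x            ∎

  b^q*x : ∀ {x} → μ x → b x ^ q * x ≈ ω ^ q + x
  b^q*x {x} x∈μ = begin
    (ω * x + 1#) ^ q * x        ≈⟨ *-congʳ (^q-distrib-+ (ω * x) 1#) ⟩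
    ((ω * x) ^ q + 1# ^ q) * x  ≈⟨ *-congʳ (+-cong (^-distrib-* ω x q) (1^n≈1 q)) ⟩
    (ω ^ q * x ^ q + 1#) * x    ≈⟨ solve 3 (λ x y w → (w :* y :+ con 1ℤ) :* x := w :* (x :* y) :+ x) refl x (x ^ q) (ω ^ q) ⟩
    ω ^ q * (x * x ^ q) + x     ≈⟨ +-congʳ (trans (*-congˡ x∈μ) (*-identityʳ _)) ⟩
    ω ^ q + x                   ∎

  [ab]^q : ∀ {x y} → (a x * b y) ^ q * (x * y) ≈ (a x ^ q * x) * (b y ^ q * y)
  [ab]^q {x} {y} = begin
    (a x * b y) ^ q * (x * y)         ≈⟨ *-congʳ (^-distrib-* (a x) (b y) q) ⟩
    a x ^ q * b y ^ q * (x * y)       ≈⟨ solve 4 (λ a b x y → a :* b :* (x :* y) := (a :* x) :* (b :* y)) refl (a x ^ q) (b y ^ q) x y ⟩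
    (a x ^ q * x) * (b y ^ q * y)     ∎

  ad-bc : ∀ x y → a x * b y - a y * b x ≈ (1# - ω * ω) * (x - y)
  ad-bc x y = solve 3 (λ w x y → (x :+ w) :* (w :* y :+ con 1ℤ) :- (y :+ w) :* (w :* x :+ con 1ℤ)
    := (con 1ℤ :- w :* w) :* (x :- y)) refl ω x y

  -- Cross-multiplied injectivity of the degree-one function a / b, the determinant
  -- of which is 1 - ω².
  a*b-injective : ∀ {x y} → a x * b y ≈ a y * b x → x ≈ y
  a*b-injective {x} {y} eq = x∙y⁻¹≈ε⇒x≈y x y
    (*≈0 1-ω²≉0 (trans (sym (ad-bc x y)) (x≈y⇒x∙y⁻¹≈ε eq)))

  -- c₂ / c₁ is the degree-one function of (a / b)^n with matrix rows (1, -ω) and (-ω, 1);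
  -- cancelling the determinant 1 - ω² leaves the n-th powers.
  c₂*c₁-injective : ∀ {x y} → c₂ x * c₁ y ≈ c₂ y * c₁ x → (a x * b y) ^ n ≈ (a y * b x) ^ n
  c₂*c₁-injective {x} {y} eq = begin
    (a x * b y) ^ n         ≈⟨ ^-distrib-* (a x) (b y) n ⟩
    a x ^ n * b y ^ n       ≈⟨ x∙y⁻¹≈ε⇒x≈y _ _ (*≈0 1-ω²≉0 (begin
      (1# - ω * ω) * (a x ^ n * b y ^ n - a y ^ n * b x ^ n)
        ≈⟨ solve 5 (λ w A B A′ B′ → (con 1ℤ :- w :* w) :* (A :* B′ :- A′ :* B)
             := (A :- w :* B) :* (B′ :- w :* A′) :- (A′ :- w :* B′) :* (B :- w :* A)) refl
             ω (a x ^ n) (b x ^ n) (a y ^ n) (b y ^ n) ⟩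
      c₂ x * c₁ y - c₂ y * c₁ x
        ≈⟨ x≈y⇒x∙y⁻¹≈ε eq ⟩
      0# ∎)) ⟩
    a y ^ n * b x ^ n       ≈⟨ ^-distrib-* (a y) (b x) n ⟨
    (a y * b x) ^ n         ∎

  a≈0∧b≈0⇒ω²≈1 : ∀ {x} → a x ≈ 0# → b x ≈ 0# → ω * ω ≈ 1#
  a≈0∧b≈0⇒ω²≈1 {x} a≈0 b≈0 = x∙y⁻¹≈ε⇒x≈y _ _ (begin
    ω * ω - 1#          ≈⟨ solve 2 (λ w x → w :* w :- con 1ℤ := w :* (x :+ w) :- (w :* x :+ con 1ℤ)) refl ω x ⟩
    ω * a x - b x       ≈⟨ +-cong (trans (*-congˡ a≈0) (zeroʳ ω)) (-‿cong b≈0) ⟩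
    0# - 0#             ≈⟨ -‿inverseʳ 0# ⟩
    0#                  ∎)

  eigen≈0 : ∀ {u v} → u - ω * v ≈ 0# → v - ω * u ≈ 0# → u ≈ 0#
  eigen≈0 {u} {v} u≈ωv v≈ωu = *≈0 1-ω²≉0 (begin
    (1# - ω * ω) * u              ≈⟨ solve 3 (λ w u v → (con 1ℤ :- w :* w) :* u := (u :- w :* v) :+ w :* (v :- w :* u)) refl ω u v ⟩
    (u - ω * v) + ω * (v - ω * u) ≈⟨ +-cong u≈ωv (trans (*-congˡ v≈ωu) (zeroʳ ω)) ⟩
    0# + 0#                       ≈⟨ +-identityˡ 0# ⟩
    0#                            ∎)

  ¬c₁≈0×c₂≈0 : ∀ {x} → c₁ x ≈ 0# → ¬ (c₂ x ≈ 0#)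
  ¬c₁≈0×c₂≈0 {x} c₁≈0 c₂≈0 =
    ω²≉1 (a≈0∧b≈0⇒ω²≈1 (^≈0⇒≈0 n (eigen≈0 c₂≈0 c₁≈0)) (^≈0⇒≈0 n (eigen≈0 c₁≈0 c₂≈0)))

  c₁≈c₂ : ∀ {x} → a x ^ n ≈ b x ^ n → c₁ x ≈ c₂ x
  c₁≈c₂ eq = +-cong (sym eq) (-‿cong (*-congˡ eq))

  -- Common to both residues of q. `a*b-^l` says that the quotient of two nonzero finite values of a
  -- / b is an l-th root of unity. For such a root ζ, `ω^l≉1` and `norms` ensure that its preimage
  -- (ζ - ω) / (1 - ωζ) has a nonzero denominator and lies in μ.
  module Criterion
    (l : ℕ) (l∣ : l ∣ q-1 ℕ.* suc q)
    (κ : Carrier) (κ≉0 : ¬ (κ ≈ 0#))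
    (conjugate₁ : ∀ {x} → μ x → x ^ n * c₁ x ^ q ≈ κ * c₂ x)
    (conjugate₂ : ∀ {x} → μ x → x ^ n * c₂ x ^ q ≈ κ * c₁ x)
    (a*b-^l : ∀ {x y} → μ x → μ y → ¬ (a x * b y ≈ 0#) → ¬ (a y * b x ≈ 0#) →
      (a x * b y) ^ l ≈ (a y * b x) ^ l)
    (ω^l≉1 : ¬ (ω ^ l ≈ 1#))
    (norms : ∀ {ζ} → ζ ^ l ≈ 1# → (ζ - ω) ^ suc q ≈ (1# - ω * ζ) ^ suc q)
    where

    ^n*≈0⇒≈0 : ∀ {x u v} → x ^ n * u ^ q ≈ κ * v → u ≈ 0# → v ≈ 0#
    ^n*≈0⇒≈0 {x} {u} {v} eq u≈0 = *≈0 κ≉0 (begin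
      κ * v             ≈⟨ eq ⟨
      x ^ n * u ^ q     ≈⟨ *-congˡ (≈0⇒^≈0 {n = q} (s≤s z≤n) u≈0) ⟩
      x ^ n * 0#        ≈⟨ zeroʳ _ ⟩
      0#                ∎)

    -- A zero of `c₁` on μ would by conjugation be one of `c₂` too, hence a common zero of a and b,
    -- which forces ω² = 1.
    c₁≉0 : ∀ {x} → μ x → ¬ (c₁ x ≈ 0#)
    c₁≉0 x∈μ c₁≈0 = ¬c₁≈0×c₂≈0 c₁≈0 (^n*≈0⇒≈0 (conjugate₁ x∈μ) c₁≈0)

    c₂≉0 : ∀ {x} → μ x → ¬ (c₂ x ≈ 0#)
    c₂≉0 x∈μ c₂≈0 = ¬c₁≈0×c₂≈0 (^n*≈0⇒≈0 (conjugate₂ x∈μ) c₂≈0) c₂≈0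

    separates : gcd n l ≡ 1 → ∀ {x y} → μ x → μ y → c₂ x * c₁ y ≈ c₂ y * c₁ x → x ≈ y
    separates gcd≡1 {x} {y} x∈μ y∈μ eq = a*b-injective ab≈
      where
      abⁿ≈ : (a x * b y) ^ n ≈ (a y * b x) ^ n
      abⁿ≈ = c₂*c₁-injective eq
      ab≈ : a x * b y ≈ a y * b x
      -- A product vanishes at a zero or a pole of a / b, where l-th powers give no information. As
      -- n is positive, equality of the n-th powers makes both products vanish or neither.
      ab≈ with a x * b y ≟ 0# | a y * b x ≟ 0#
      ... | yes u≈0 | yes v≈0 = trans u≈0 (sym v≈0)
      ... | yes u≈0 | no  v≉0 = contradiction (trans (sym abⁿ≈) (≈0⇒^≈0 0<n u≈0)) (^≉0 n v≉0)
      ... | no  u≉0 | yes v≈0 = contradiction (trans abⁿ≈ (≈0⇒^≈0 0<n v≈0)) (^≉0 n u≉0)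
      ... | no  u≉0 | no  v≉0 = coprime-powers-injective n l gcd≡1 v≉0 abⁿ≈ (a*b-^l x∈μ y∈μ u≉0 v≉0)

    -- The solution (ζ - ω) / (1 - ω ζ) of a x / b x = ζ.
    preimage : ∀ {ζ} → ζ ^ l ≈ 1# → ¬ (ζ ≈ 1#) → ∃ λ x → μ x × ¬ (x ≈ 1#) × a x ≈ ζ * b x
    preimage {ζ} ζ^l≈1 ζ≉1 = x , x∈μ , x≉1 , ax≈ζbx
      where
      num den : Carrier
      num = ζ - ω
      den = 1# - ω * ζ
      den≉0 : ¬ (den ≈ 0#)
      den≉0 = ≉⇒-≉0 λ 1≈ωζ → ω^l≉1 (begin
        ω ^ l           ≈⟨ *-identityʳ _ ⟨
        ω ^ l * 1#      ≈⟨ *-congˡ ζ^l≈1 ⟨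
        ω ^ l * ζ ^ l   ≈⟨ ^-distrib-* ω ζ l ⟨
        (ω * ζ) ^ l     ≈⟨ ^-congˡ l 1≈ωζ ⟨
        1# ^ l          ≈⟨ 1^n≈1 l ⟩
        1#              ∎)
      den⁻¹ : Carrier
      den⁻¹ = proj₁ (inverse den≉0)
      x : Carrier
      x = num * den⁻¹
      x*den≈num : x * den ≈ num
      x*den≈num = begin
        num * den⁻¹ * den     ≈⟨ solve 3 (λ n i d → n :* i :* d := n :* (d :* i)) refl num den⁻¹ den ⟩
        num * (den * den⁻¹)   ≈⟨ *-congˡ (proj₂ (inverse den≉0)) ⟩
        num * 1#              ≈⟨ *-identityʳ num ⟩
        num                   ∎
      x∈μ : μ x
      x∈μ = *-cancelʳ (^≉0 (suc q) den≉0) (begin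
        x ^ suc q * den ^ suc q   ≈⟨ ^-distrib-* x den (suc q) ⟨
        (x * den) ^ suc q         ≈⟨ ^-congˡ (suc q) x*den≈num ⟩
        num ^ suc q               ≈⟨ norms ζ^l≈1 ⟩
        den ^ suc q               ≈⟨ *-identityˡ _ ⟨
        1# * den ^ suc q          ∎)
      x≉1 : ¬ (x ≈ 1#)
      -- `num - den` is (1 + ω)(ζ - 1), so 1 is the preimage of no other value than 1.
      x≉1 x≈1 = ζ≉1 (*-cancelˡ 1+ω≉0 (x∙y⁻¹≈ε⇒x≈y _ _ (begin
        (1# + ω) * ζ - (1# + ω) * 1#
          ≈⟨ solve 2 (λ w z → (con 1ℤ :+ w) :* z :- (con 1ℤ :+ w) :* con 1ℤ := (z :- w) :- con 1ℤ :* (con 1ℤ :- w :* z)) refl ω ζ ⟩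
        num - 1# * den
          ≈⟨ +-congˡ (-‿cong (*-congʳ x≈1)) ⟨
        num - x * den
          ≈⟨ x≈y⇒x∙y⁻¹≈ε (sym x*den≈num) ⟩
        0# ∎)))
      ax≈ζbx : a x ≈ ζ * b x
      ax≈ζbx = *-cancelʳ den≉0 (begin
        (x + ω) * den                   ≈⟨ distribʳ den x ω ⟩
        x * den + ω * den               ≈⟨ +-congʳ x*den≈num ⟩
        num + ω * den                   ≈⟨ solve 2 (λ w z → (z :- w) :+ w :* (con 1ℤ :- w :* z)
                                             := z :* (w :* (z :- w) :+ (con 1ℤ :- w :* z))) refl ω ζ ⟩
        ζ * (ω * num + den)             ≈⟨ *-congˡ (+-congʳ (*-congˡ x*den≈num)) ⟨
        ζ * (ω * (x * den) + den)       ≈⟨ solve 4 (λ w z x d → z :* (w :* (x :* d) :+ d) := z :* (w :* x :+ con 1ℤ) :* d) refl ω ζ x den ⟩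
        ζ * (ω * x + 1#) * den          ∎)

    collides : ¬ (gcd n l ≡ 1) → ∃ λ x → μ x × ¬ (x ≈ 1#) × c₁ x ≈ c₂ x
    collides ≢1 = fromRoot (∃-root-of-unity (gcd≢1⇒1<gcd 0<n ≢1) (∣-trans (gcd[m,n]∣n n l) l∣) 0<[q-1]*[q+1])
      where
      fromRoot : (∃ λ ζ → ¬ (ζ ≈ 1#) × ζ ^ gcd n l ≈ 1#) → ∃ λ x → μ x × ¬ (x ≈ 1#) × c₁ x ≈ c₂ x
      fromRoot (ζ , ζ≉1 , ζ^≈1) =
        let x , x∈μ , x≉1 , ax≈ζbx = preimage (^-∣≈1 (gcd[m,n]∣n n l) ζ^≈1) ζ≉1
        in x , x∈μ , x≉1 , c₁≈c₂ (begin
          a x ^ n           ≈⟨ ^-congˡ n ax≈ζbx ⟩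
          (ζ * b x) ^ n     ≈⟨ ^-distrib-* ζ (b x) n ⟩
          ζ ^ n * b x ^ n   ≈⟨ *-congʳ (^-∣≈1 (gcd[m,n]∣m n l) ζ^≈1) ⟩
          1# * b x ^ n      ≈⟨ *-identityˡ _ ⟩
          b x ^ n           ∎)

    c₁1≈c₂1 : c₁ 1# ≈ c₂ 1#
    c₁1≈c₂1 = c₁≈c₂ (^-congˡ n (solve 1 (λ w → con 1ℤ :+ w := w :* con 1ℤ :+ con 1ℤ) refl ω))

    module _ {r : ℕ} (0<r : 0 ℕ.< r) (r≡n : r % suc q ≡ n % suc q) where

      c₁-criterion : Injective _≈_ _≈_ (λ u → u ^ r * c₁ (u ^ q-1)) ⇔ (gcd r q-1 ≡ 1 × gcd n l ≡ 1)
      c₁-criterion = PermutationCriterion.h-injective⇔ n l r 0<r r≡n c₁ c₂ c₁-cong c₂-cong κ κ≉0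
        c₁≉0 conjugate₁ separates
        (λ ≢1 → let x , x∈μ , x≉1 , eq = collides ≢1 in
          x , x∈μ , x≉1 , trans (*-cong (sym eq) c₁1≈c₂1) (*-comm _ _))

      -- The cross-multiplied equations for the reciprocal c₁ / c₂ are those for c₂ / c₁ with the
      -- factors exchanged.
      c₂-criterion : Injective _≈_ _≈_ (λ u → u ^ r * c₂ (u ^ q-1)) ⇔ (gcd r q-1 ≡ 1 × gcd n l ≡ 1)
      c₂-criterion = PermutationCriterion.h-injective⇔ n l r 0<r r≡n c₂ c₁ c₂-cong c₁-cong κ κ≉0
        c₂≉0 conjugate₂
        (λ gcd≡1 x∈μ y∈μ eq → sym (separates gcd≡1 y∈μ x∈μ (trans (*-comm _ _) (trans eq (*-comm _ _)))))
        (λ ≢1 → let x , x∈μ , x≉1 , eq = collides ≢1 in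
          x , x∈μ , x≉1 , trans (*-cong eq (sym c₁1≈c₂1)) (*-comm _ _))

  -- Here ω lies in the field of q elements. Conjugation on μ exchanges a and b up to a factor x, so
  -- the values of a / b have norm 1: they lie in μ again, and l = q + 1.
  module SplitCase (ω^q≈ω : ω ^ q ≈ ω) where

    a^q*x≈b : ∀ {x} → μ x → a x ^ q * x ≈ b x
    a^q*x≈b {x} x∈μ = begin
      a x ^ q * x     ≈⟨ a^q*x x∈μ ⟩
      1# + ω ^ q * x  ≈⟨ +-comm _ _ ⟩
      ω ^ q * x + 1#  ≈⟨ +-congʳ (*-congʳ ω^q≈ω) ⟩
      b x             ∎

    b^q*x≈a : ∀ {x} → μ x → b x ^ q * x ≈ a x
    b^q*x≈a x∈μ = trans (b^q*x x∈μ) (trans (+-comm _ _) (+-congˡ ω^q≈ω))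

    conjugate₁ : ∀ {x} → μ x → x ^ n * c₁ x ^ q ≈ 1# * c₂ x
    conjugate₁ {x} x∈μ = begin
      x ^ n * c₁ x ^ q                                    ≈⟨ ^q-form (b x) (a x) x ⟩
      (b x ^ q * x) ^ n - ω ^ q * (a x ^ q * x) ^ n       ≈⟨ +-cong (^-congˡ n (b^q*x≈a x∈μ))
                                                               (-‿cong (*-cong ω^q≈ω (^-congˡ n (a^q*x≈b x∈μ)))) ⟩
      c₂ x                                                ≈⟨ *-identityˡ _ ⟨
      1# * c₂ x                                           ∎

    conjugate₂ : ∀ {x} → μ x → x ^ n * c₂ x ^ q ≈ 1# * c₁ x
    conjugate₂ {x} x∈μ = begin
      x ^ n * c₂ x ^ q                                    ≈⟨ ^q-form (a x) (b x) x ⟩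
      (a x ^ q * x) ^ n - ω ^ q * (b x ^ q * x) ^ n       ≈⟨ +-cong (^-congˡ n (a^q*x≈b x∈μ))
                                                               (-‿cong (*-cong ω^q≈ω (^-congˡ n (b^q*x≈a x∈μ)))) ⟩
      c₁ x                                                ≈⟨ *-identityˡ _ ⟨
      1# * c₁ x                                           ∎

    a*b-^q : ∀ {x y} → μ x → μ y → (a x * b y) ^ q * (x * y) ≈ a y * b x
    a*b-^q {x} {y} x∈μ y∈μ = begin
      (a x * b y) ^ q * (x * y)       ≈⟨ [ab]^q ⟩
      (a x ^ q * x) * (b y ^ q * y)   ≈⟨ *-cong (a^q*x≈b x∈μ) (b^q*x≈a y∈μ) ⟩
      b x * a y                       ≈⟨ *-comm _ _ ⟩
      a y * b x                       ∎

    a*b-^[q+1] : ∀ {x y} → μ x → μ y → (a x * b y) ^ suc q ≈ (a y * b x) ^ suc q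
    a*b-^[q+1] {x} {y} x∈μ y∈μ = *-cancelʳ (*≉0 (μ⇒≉0 x∈μ) (μ⇒≉0 y∈μ)) (begin
      u * u ^ q * (x * y)     ≈⟨ *-assoc _ _ _ ⟩
      u * (u ^ q * (x * y))   ≈⟨ *-congˡ (a*b-^q x∈μ y∈μ) ⟩
      u * v                   ≈⟨ *-comm u v ⟩
      v * u                   ≈⟨ *-congˡ (a*b-^q y∈μ x∈μ) ⟨
      v * (v ^ q * (y * x))   ≈⟨ *-congˡ (*-congˡ (*-comm y x)) ⟩
      v * (v ^ q * (x * y))   ≈⟨ *-assoc _ _ _ ⟨
      v * v ^ q * (x * y)     ∎)
      where
      u v : Carrier
      u = a x * b y
      v = a y * b x

    norms : ∀ {ζ} → ζ ^ suc q ≈ 1# → (ζ - ω) ^ suc q ≈ (1# - ω * ζ) ^ suc q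
    norms {ζ} ζ^≈1 = begin
      (ζ - ω) * (ζ - ω) ^ q
        ≈⟨ *-congˡ (trans (^-distrib-- ζ ω) (+-congˡ (-‿cong ω^q≈ω))) ⟩
      (ζ - ω) * (ζ ^ q - ω)
        ≈⟨ solve 3 (λ w z y → (z :- w) :* (y :- w) := z :* y :- w :* (z :+ y) :+ w :* w) refl ω ζ (ζ ^ q) ⟩
      ζ * ζ ^ q - ω * (ζ + ζ ^ q) + ω * ω
        ≈⟨ +-cong (+-congʳ ζ^≈1) (trans (sym (*-identityʳ _)) (*-congˡ (sym ζ^≈1))) ⟩
      1# - ω * (ζ + ζ ^ q) + ω * ω * (ζ * ζ ^ q)
        ≈⟨ solve 3 (λ w z y → con 1ℤ :- w :* (z :+ y) :+ w :* w :* (z :* y)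
             := (con 1ℤ :- w :* z) :* (con 1ℤ :- w :* y)) refl ω ζ (ζ ^ q) ⟩
      (1# - ω * ζ) * (1# - ω * ζ ^ q)
        ≈⟨ *-congˡ (+-cong (1^n≈1 q) (-‿cong (trans (^-distrib-* ω ζ q) (*-congʳ ω^q≈ω)))) ⟨
      (1# - ω * ζ) * (1# ^ q - (ω * ζ) ^ q)
        ≈⟨ *-congˡ (^-distrib-- 1# (ω * ζ)) ⟨
      (1# - ω * ζ) * (1# - ω * ζ) ^ q ∎

    open Criterion (suc q) (n∣m*n q-1) 1# 1≉0 conjugate₁ conjugate₂
      (λ x∈μ y∈μ _ _ → a*b-^[q+1] x∈μ y∈μ)
      (λ ω^≈1 → ω²≉1 (trans (*-congˡ (sym ω^q≈ω)) ω^≈1)) norms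
      public using (c₁-criterion; c₂-criterion)

  -- Here ω^q is the other primitive cube root of unity. Conjugation on μ multiplies a and b by the
  -- same factor ω² / x, so the finite values of a / b lie in the field of q elements, and l = q -
  -- 1.
  module InertCase (ω^q≈ω² : ω ^ q ≈ ω * ω) where

    a^q*x≈ω²a : ∀ {x} → μ x → a x ^ q * x ≈ ω * ω * a x
    a^q*x≈ω²a {x} x∈μ = begin
      a x ^ q * x             ≈⟨ a^q*x x∈μ ⟩
      1# + ω ^ q * x          ≈⟨ +-cong (sym ω³≈1) (*-congʳ ω^q≈ω²) ⟩
      ω * ω * ω + ω * ω * x   ≈⟨ solve 2 (λ w x → w :* w :* w :+ w :* w :* x := w :* w :* (x :+ w)) refl ω x ⟩
      ω * ω * a x             ∎

    b^q*x≈ω²b : ∀ {x} → μ x → b x ^ q * x ≈ ω * ω * b x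
    b^q*x≈ω²b {x} x∈μ = begin
      b x ^ q * x             ≈⟨ b^q*x x∈μ ⟩
      ω ^ q + x               ≈⟨ +-cong ω^q≈ω² (trans (sym (*-identityˡ x)) (*-congʳ (sym ω³≈1))) ⟩
      ω * ω + ω * ω * ω * x   ≈⟨ solve 2 (λ w x → w :* w :+ w :* w :* w :* x := w :* w :* (w :* x :+ con 1ℤ)) refl ω x ⟩
      ω * ω * b x             ∎

    -- Conjugation turns c₁ into ω^(2n) (b^n - ω² a^n) up to the factor x^n; since ω³ = 1, pulling
    -- out -ω² leaves c₂.
    κ : Carrier
    κ = - ((ω * ω) ^ n * (ω * ω))

    κ≉0 : ¬ (κ ≈ 0#)
    κ≉0 κ≈0 = *≉0 (^≉0 n (*≉0 ω≉0 ω≉0)) (*≉0 ω≉0 ω≉0) (begin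
      (ω * ω) ^ n * (ω * ω)   ≈⟨ solve 1 (λ k → k := con 0ℤ :- (:- k)) refl _ ⟩
      0# - κ                  ≈⟨ +-congˡ (-‿cong κ≈0) ⟩
      0# - 0#                 ≈⟨ -‿inverseʳ 0# ⟩
      0#                      ∎)

    ^q-form-inert : ∀ {u v x} → u ^ q * x ≈ ω * ω * u → v ^ q * x ≈ ω * ω * v →
      x ^ n * (u ^ n - ω * v ^ n) ^ q ≈ κ * (v ^ n - ω * u ^ n)
    ^q-form-inert {u} {v} {x} uσ vσ = begin
      x ^ n * (u ^ n - ω * v ^ n) ^ q
        ≈⟨ ^q-form u v x ⟩
      (u ^ q * x) ^ n - ω ^ q * (v ^ q * x) ^ n
        ≈⟨ +-cong (trans (^-congˡ n uσ) (^-distrib-* (ω * ω) u n))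
             (-‿cong (*-cong ω^q≈ω² (trans (^-congˡ n vσ) (^-distrib-* (ω * ω) v n)))) ⟩
      W * u ^ n - ω * ω * (W * v ^ n)
        -- The relation ω³ = 1 is unknown to the solver; it is inserted where ω² has to be pulled
        -- out.
        ≈⟨ +-congʳ (*-congʳ (trans (sym (*-identityʳ W)) (*-congˡ (sym ω³≈1)))) ⟩
      W * (ω * ω * ω) * u ^ n - ω * ω * (W * v ^ n)
        ≈⟨ solve 4 (λ W w u v → W :* (w :* w :* w) :* u :- w :* w :* (W :* v)
             := :- (W :* (w :* w)) :* (v :- w :* u)) refl W ω (u ^ n) (v ^ n) ⟩
      κ * (v ^ n - ω * u ^ n) ∎
      where
      W : Carrier
      W = (ω * ω) ^ n

    -- The right-hand side does not depend on x and y; comparing with the exchanged pair gives the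
    -- equality of (q-1)-th powers required as `a*b-^l`.
    a*b-^[q-1] : ∀ {x y} → μ x → μ y → ¬ (a x * b y ≈ 0#) → (a x * b y) ^ q-1 * (x * y) ≈ (ω * ω) * (ω * ω)
    a*b-^[q-1] {x} {y} x∈μ y∈μ ab≉0 = *-cancelˡ ab≉0 (begin
      a x * b y * ((a x * b y) ^ q-1 * (x * y))   ≈⟨ *-assoc _ _ _ ⟨
      (a x * b y) ^ q * (x * y)                   ≈⟨ [ab]^q ⟩
      (a x ^ q * x) * (b y ^ q * y)               ≈⟨ *-cong (a^q*x≈ω²a x∈μ) (b^q*x≈ω²b y∈μ) ⟩
      ω * ω * a x * (ω * ω * b y)                 ≈⟨ solve 3 (λ w a b → w :* a :* (w :* b) := a :* b :* (w :* w)) refl (ω * ω) (a x) (b y) ⟩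
      a x * b y * (ω * ω * (ω * ω))               ∎)

    -- ζ lies in the field of q elements, so the norm of ζ - ω is (ζ - ω)(ζ - ω²), the value at ζ of
    -- X² + X + 1, a polynomial equal to its reciprocal.
    norms : ∀ {ζ} → ζ ^ q-1 ≈ 1# → (ζ - ω) ^ suc q ≈ (1# - ω * ζ) ^ suc q
    norms {ζ} ζ^≈1 = begin
      (ζ - ω) * (ζ - ω) ^ q
        ≈⟨ *-congˡ (trans (^-distrib-- ζ ω) (+-cong ζ^q≈ζ (-‿cong ω^q≈ω²))) ⟩
      (ζ - ω) * (ζ - ω * ω)
        ≈⟨ solve 2 (λ w z → (z :- w) :* (z :- w :* w) := z :* z :- (w :+ w :* w) :* z :+ w :* w :* w) refl ω ζ ⟩
      ζ * ζ - (ω + ω * ω) * ζ + ω * ω * ω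
        ≈⟨ +-cong (+-congʳ (trans (sym (*-identityˡ _)) (*-congʳ (sym ω³≈1)))) ω³≈1 ⟩
      ω * ω * ω * (ζ * ζ) - (ω + ω * ω) * ζ + 1#
        ≈⟨ solve 2 (λ w z → w :* w :* w :* (z :* z) :- (w :+ w :* w) :* z :+ con 1ℤ
             := (con 1ℤ :- w :* z) :* (con 1ℤ :- w :* w :* z)) refl ω ζ ⟩
      (1# - ω * ζ) * (1# - ω * ω * ζ)
        ≈⟨ *-congˡ (+-cong (1^n≈1 q) (-‿cong (trans (^-distrib-* ω ζ q) (*-cong ω^q≈ω² ζ^q≈ζ)))) ⟨
      (1# - ω * ζ) * (1# ^ q - (ω * ζ) ^ q)
        ≈⟨ *-congˡ (^-distrib-- 1# (ω * ζ)) ⟨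
      (1# - ω * ζ) * (1# - ω * ζ) ^ q ∎
      where
      ζ^q≈ζ : ζ ^ q ≈ ζ
      ζ^q≈ζ = trans (*-congˡ ζ^≈1) (*-identityʳ ζ)

    open Criterion q-1 (m∣m*n (suc q)) κ κ≉0
      (λ x∈μ → ^q-form-inert (b^q*x≈ω²b x∈μ) (a^q*x≈ω²a x∈μ))
      (λ x∈μ → ^q-form-inert (a^q*x≈ω²a x∈μ) (b^q*x≈ω²b x∈μ))
      (λ x∈μ y∈μ u≉0 v≉0 → *-cancelʳ (*≉0 (μ⇒≉0 x∈μ) (μ⇒≉0 y∈μ))
        (trans (a*b-^[q-1] x∈μ y∈μ u≉0)
          (sym (trans (*-congˡ (*-comm _ _)) (a*b-^[q-1] y∈μ x∈μ v≉0)))))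
      (λ ω^≈1 → ω≉1 (*-cancelˡ ω≉0 (trans (sym ω^q≈ω²) (*-congˡ ω^≈1))))
      norms
      public using (c₁-criterion; c₂-criterion)

-- The polynomials C₁ and C₂

module Polynomials {c ℓ₁ ℓ₂} (F : HeytingField c ℓ₁ ℓ₂) where
  open OverField F
  A : CommutativeRing c ℓ₁
  A = HeytingCommutativeRing.commutativeRing (HeytingField.heytingCommutativeRing F)
  open CommutativeRing A renaming (zero to *-zero)
  open IntegerCoefficients A
  open import Algebra.Properties.CommutativeSemiring.Exp commutativeSemiring
  open import Algebra.Properties.Semiring.Mult semiring using (×-homo-+) renaming (_×_ to _·_)
  open import Algebra.Properties.AbelianGroup +-abelianGroup using (inverseʳ-unique)
  open import Relation.Binary.Reasoning.Setoid setoid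

  eval-cong : ∀ f → Congruent _≈_ _≈_ (eval f)
  eval-cong []            x≈y = refl
  eval-cong ((a , m) ∷ f) x≈y = +-cong (*-congˡ (^-congˡ m x≈y)) (eval-cong f x≈y)

  eval-scale : ∀ k f x → eval (scale k f) x ≈ k * eval f x
  eval-scale k []            x = sym (zeroʳ k)
  eval-scale k ((a , m) ∷ f) x = begin
    k * a * x ^ m + eval (scale k f) x    ≈⟨ +-cong (*-assoc k a (x ^ m)) (eval-scale k f x) ⟩
    k * (a * x ^ m) + k * eval f x        ≈⟨ distribˡ k _ _ ⟨
    k * (a * x ^ m + eval f x)            ∎

  eval-shift : ∀ n f x → eval (shift n f) x ≈ x ^ n * eval f x
  eval-shift n []            x = sym (zeroʳ _)
  eval-shift n ((a , m) ∷ f) x = begin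
    a * x ^ (n ℕ.+ m) + eval (shift n f) x    ≈⟨ +-cong (*-congˡ (^-homo-* x n m)) (eval-shift n f x) ⟩
    a * (x ^ n * x ^ m) + x ^ n * eval f x    ≈⟨ solve 4 (λ a u v e → a :* (u :* v) :+ u :* e := u :* (a :* v :+ e)) refl a (x ^ n) (x ^ m) (eval f x) ⟩
    x ^ n * (a * x ^ m + eval f x)            ∎

  eval-expand : ∀ n f x → eval (expand n f) x ≈ eval f (x ^ n)
  eval-expand n []            x = refl
  eval-expand n ((a , m) ∷ f) x = +-cong (*-congˡ (sym (^-assocʳ x n m))) (eval-expand n f x)

  coeff-∷-≢ : ∀ {m i} a f → m ≢ i → coeff ((a , m) ∷ f) i ≈ coeff f i
  coeff-∷-≢ {m} {i} a f m≢i = trans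
    (reflexive (≡.cong (λ b → (if b then a else 0#) + coeff f i) (dec-false (m ℕ.≟ i) m≢i)))
    (+-identityˡ _)

  coeff-∷-≡ : ∀ {m i} a f → m ≡ i → coeff ((a , m) ∷ f) i ≈ a + coeff f i
  coeff-∷-≡ {m} {i} a f m≡i =
    reflexive (≡.cong (λ b → (if b then a else 0#) + coeff f i) (dec-true (m ℕ.≟ i) m≡i))

  coeff-∷-0 : ∀ {m a i} f → a ≈ 0# → coeff ((a , m) ∷ f) i ≈ coeff f i
  coeff-∷-0 {m} {a} {i} f a≈0 with m ℕ.≟ i
  ... | yes m≡i = trans (coeff-∷-≡ a f m≡i) (trans (+-congʳ a≈0) (+-identityˡ _))
  ... | no  m≢i = coeff-∷-≢ a f m≢i

  coeff≈0 : ∀ {i} f → All (i ≢_) (map proj₂ f) → coeff f i ≈ 0#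
  coeff≈0 []            []          = refl
  coeff≈0 ((a , m) ∷ f) (i≢m ∷ i∉f) = trans (coeff-∷-≢ a f (λ m≡i → i≢m (≡.sym m≡i))) (coeff≈0 f i∉f)

  -- The exponents are selected by given flags, as vanishing of a coefficient cannot be tested in an
  -- arbitrary Heyting field; the flags will come from residues modulo 3.
  keptExponents : List Bool → Poly → List ℕ
  keptExponents []           f             = []
  keptExponents (b ∷ bs)     []            = []
  keptExponents (true  ∷ bs) ((a , m) ∷ f) = m ∷ keptExponents bs f
  keptExponents (false ∷ bs) (_ ∷ f)       = keptExponents bs f

  ZeroUnless : Bool → Carrier × ℕ → Set ℓ₁
  ZeroUnless b t = b ≡ false → proj₁ t ≈ 0#

  length-kept : ∀ {bs f} → Pointwise ZeroUnless bs f → length (keptExponents bs f) ≡ count bs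
  length-kept []                  = ≡.refl
  length-kept (_∷_ {true}  _ zs)  = ≡.cong suc (length-kept zs)
  length-kept (_∷_ {false} _ zs)  = length-kept zs

  ∈-kept : ∀ {bs f} → Pointwise ZeroUnless bs f → ∀ i → IsTerm f i → i ∈ keptExponents bs f
  ∈-kept []                                   i term = contradiction refl term
  ∈-kept (_∷_ {true} {a , m} {_} {f} z zs)    i term with m ℕ.≟ i
  ... | yes m≡i = here (≡.sym m≡i)
  ... | no  m≢i = there (∈-kept zs i λ eq → term (trans (coeff-∷-≢ a f m≢i) eq))
  ∈-kept (_∷_ {false} {a , m} {_} {f} z zs)   i term =
    ∈-kept zs i λ eq → term (trans (coeff-∷-0 {m} f (z ≡.refl)) eq)

  atMostTerms : ∀ {bs f} → Pointwise ZeroUnless bs f → AtMostTerms (count bs) f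
  atMostTerms {bs} {f} zs = keptExponents bs f , ℕ.≤-reflexive (length-kept zs) , ∈-kept zs

  Ternary : Carrier → Set ℓ₁
  Ternary x = x ≈ 0# ⊎ x ≈ 1# ⊎ x ≈ - 1#

  TernaryCoeffs : Poly → Set _
  TernaryCoeffs = All (λ t → Ternary (proj₁ t))

  Ternary-cong : ∀ {x y} → x ≈ y → Ternary y → Ternary x
  Ternary-cong x≈y = Sum.map (trans x≈y) (Sum.map (trans x≈y) (trans x≈y))

  -- With distinct exponents every nonzero coefficient is a single entry of the list; entries with
  -- equal exponents could add up to 1 + 1.
  coeff-ternary : ∀ {f} → TernaryCoeffs f → Unique (map proj₂ f) → ∀ i → Ternary (coeff f i)
  coeff-ternary []                          []           i = inj₁ refl
  coeff-ternary (_∷_ {a , m} {f} t ts) (m∉f ∷ u)    i with m ℕ.≟ i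
  ... | yes ≡.refl = Ternary-cong
    (trans (coeff-∷-≡ a f ≡.refl) (trans (+-congˡ (coeff≈0 f m∉f)) (+-identityʳ a))) t
  ... | no  m≢i = Ternary-cong (coeff-∷-≢ a f m≢i) (coeff-ternary ts u i)

  termsHaveCoeff±1 : ∀ {f} → TernaryCoeffs f → Unique (map proj₂ f) → TermsHaveCoeff±1 f
  termsHaveCoeff±1 ts u i term with coeff-ternary ts u i
  ... | inj₁ ≈0       = contradiction ≈0 term
  ... | inj₂ ≈±1      = ≈±1

  inPrimeField-+ : ∀ {x y} → InPrimeField x → InPrimeField y → InPrimeField (x + y)
  inPrimeField-+ (m , x≈m) (n , y≈n) = m ℕ.+ n , trans (+-cong x≈m y≈n) (sym (×-homo-+ 1# m n))

  -- `InPrimeField` asks for a natural multiple of 1, and -1 is `m · 1#` once `suc m · 1#` is 0. In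
  -- the application `suc m` is the cardinality.
  ternary⇒inPrimeField : ∀ m {x} → suc m · 1# ≈ 0# → Ternary x → InPrimeField x
  ternary⇒inPrimeField _ _     (inj₁ x≈0)         = 0 , x≈0
  ternary⇒inPrimeField _ _     (inj₂ (inj₁ x≈1))  = 1 , trans x≈1 (sym (+-identityʳ 1#))
  ternary⇒inPrimeField m m·1≈0 (inj₂ (inj₂ x≈-1)) = m , trans x≈-1 (sym (inverseʳ-unique _ _ m·1≈0))

  coeffsInPrimeField : ∀ m {f} → suc m · 1# ≈ 0# → TernaryCoeffs f → CoeffsInPrimeField f
  coeffsInPrimeField m m·1≈0 []       i = 0 , refl
  coeffsInPrimeField m m·1≈0 (_∷_ {a , e} {f} t ts) i with e ℕ.≟ i
  ... | yes e≡i = let k , a+≈k = inPrimeField-+ (ternary⇒inPrimeField m m·1≈0 t) (coeffsInPrimeField m m·1≈0 ts i)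
                  in k , trans (coeff-∷-≡ a f e≡i) a+≈k
  ... | no  e≢i = let k , ≈k = coeffsInPrimeField m m·1≈0 ts i in k , trans (coeff-∷-≢ a f e≢i) ≈k

  module _ (ω : Carrier) (Q R S : ℕ) where

    private
      n : ℕ
      n = Q ℕ.+ R ℕ.+ S

    open RedeiForms A ω n

    module EvaluateC
      (^Q-distrib-+ : Powers.AdditiveExponent A Q)
      (^R-distrib-+ : Powers.AdditiveExponent A R)
      (^S-distrib-+ : Powers.AdditiveExponent A S)
      where

      ^n : ∀ u → u ^ n ≈ u ^ Q * u ^ R * u ^ S
      ^n u = trans (^-homo-* u (Q ℕ.+ R) S) (*-congʳ (^-homo-* u Q R))

      ^n-+ : ∀ x y → (x + y) ^ n ≈ (x ^ Q + y ^ Q) * (x ^ R + y ^ R) * (x ^ S + y ^ S)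
      ^n-+ x y = trans (^n (x + y)) (*-cong (*-cong (^Q-distrib-+ x y) (^R-distrib-+ x y)) (^S-distrib-+ x y))

      ωx+1^ : ∀ m x → Powers.AdditiveExponent A m → b x ^ m ≈ ω ^ m * x ^ m + 1#
      ωx+1^ m x ^m-distrib-+ =
        trans (^m-distrib-+ (ω * x) 1#) (+-cong (^-distrib-* ω x m) (Powers.1^n≈1 A m))

      b^n : ∀ x → b x ^ n ≈ (ω ^ Q * x ^ Q + 1#) * (ω ^ R * x ^ R + 1#) * (ω ^ S * x ^ S + 1#)
      b^n x = trans (^n (b x)) (*-cong (*-cong (ωx+1^ Q x ^Q-distrib-+) (ωx+1^ R x ^R-distrib-+)) (ωx+1^ S x ^S-distrib-+))

      ^-+1 : ∀ m → ω ^ (m ℕ.+ 1) ≈ ω ^ m * ω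
      ^-+1 m = trans (^-homo-* ω m 1) (*-congˡ (*-identityʳ ω))

      ^-++1 : ∀ l m → ω ^ (l ℕ.+ m ℕ.+ 1) ≈ ω ^ l * ω ^ m * ω
      ^-++1 l m = trans (^-+1 (l ℕ.+ m)) (*-congʳ (^-homo-* ω l m))

      x^∸ : ∀ k m x → k ℕ.+ m ≡ n → x ^ (n ∸ k) ≈ x ^ m
      x^∸ k m x k+m≡n = ^-congʳ x (≡.trans (≡.cong (_∸ k) (≡.sym k+m≡n)) (ℕ.m+n∸m≡n k m))

      eval-C₁ : ∀ x → eval (C₁ ω Q R S) x ≈ c₁ x
      eval-C₁ x = begin
        eval (C₁ ω Q R S) x
          ≈⟨ +-cong (*-cong (+-congʳ (^n ω)) (^n x))
            (+-cong (*-cong (+-cong (^-homo-* ω Q R) (-‿cong (^-+1 S))) (^-homo-* x Q R))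
            (+-cong (*-cong (+-cong (^-homo-* ω Q S) (-‿cong (^-+1 R))) (^-homo-* x Q S))
            (+-cong (*-cong (+-cong (^-homo-* ω R S) (-‿cong (^-+1 Q))) (^-homo-* x R S))
            (+-cong (*-congʳ (+-congˡ (-‿cong (^-++1 R S))))
            (+-cong (*-congʳ (+-congˡ (-‿cong (^-++1 Q S))))
            (+-cong (*-congʳ (+-congˡ (-‿cong (^-++1 Q R))))
            (+-congʳ (*-congʳ (+-congˡ (-‿cong (trans (^-+1 n) (*-congʳ (^n ω))))))))))))) ⟩
        -- `q`, `r`, `s` stand for the powers of ω and `x`, `y`, `z` for those of the argument.
        -- After additivity has been used, the identity holds for seven independent variables.
        _ ≈⟨ solve 7 (λ w q r s x y z →
               (q :* r :* s :- w) :* (x :* y :* z)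
               :+ ((q :* r :- s :* w) :* (x :* y)
               :+ ((q :* s :- r :* w) :* (x :* z)
               :+ ((r :* s :- q :* w) :* (y :* z)
               :+ ((q :- r :* s :* w) :* x
               :+ ((r :- q :* s :* w) :* y
               :+ ((s :- q :* r :* w) :* z
               :+ ((con 1ℤ :- q :* r :* s :* w) :* con 1ℤ
               :+ con 0ℤ)))))))
               := (q :* x :+ con 1ℤ) :* (r :* y :+ con 1ℤ) :* (s :* z :+ con 1ℤ)
                  :- w :* ((x :+ q) :* (y :+ r) :* (z :+ s)))
               refl ω (ω ^ Q) (ω ^ R) (ω ^ S) (x ^ Q) (x ^ R) (x ^ S) ⟩
        _ ≈⟨ +-cong (b^n x) (-‿cong (*-congˡ (^n-+ x ω))) ⟨
        c₁ x ∎

      eval-C₂ : ∀ x → eval (C₂ ω Q R S) x ≈ c₂ x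
      eval-C₂ x = begin
        eval (C₂ ω Q R S) x
          ≈⟨ +-cong (*-cong (+-congʳ (^n ω)) (x^∸ n 0 x (ℕ.+-identityʳ n)))
            (+-cong (*-cong (+-cong (^-homo-* ω Q R) (-‿cong (^-+1 S))) (x^∸ (Q ℕ.+ R) S x ≡.refl))
            (+-cong (*-cong (+-cong (^-homo-* ω Q S) (-‿cong (^-+1 R))) (x^∸ (Q ℕ.+ S) R x (Q+S+R Q R S)))
            (+-cong (*-cong (+-cong (^-homo-* ω R S) (-‿cong (^-+1 Q))) (x^∸ (R ℕ.+ S) Q x (R+S+Q Q R S)))
            (+-cong (*-cong (+-congˡ (-‿cong (^-++1 R S))) (trans (x^∸ Q (R ℕ.+ S) x (Q+[R+S] Q R S)) (^-homo-* x R S)))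
            (+-cong (*-cong (+-congˡ (-‿cong (^-++1 Q S))) (trans (x^∸ R (Q ℕ.+ S) x (R+[Q+S] Q R S)) (^-homo-* x Q S)))
            (+-cong (*-cong (+-congˡ (-‿cong (^-++1 Q R))) (trans (x^∸ S (Q ℕ.+ R) x (S+[Q+R] Q R S)) (^-homo-* x Q R)))
            (+-congʳ (*-cong (+-congˡ (-‿cong (trans (^-+1 n) (*-congʳ (^n ω))))) (^n x))))))))) ⟩
        _ ≈⟨ solve 7 (λ w q r s x y z →
               (q :* r :* s :- w) :* con 1ℤ
               :+ ((q :* r :- s :* w) :* z
               :+ ((q :* s :- r :* w) :* y
               :+ ((r :* s :- q :* w) :* x
               :+ ((q :- r :* s :* w) :* (y :* z)
               :+ ((r :- q :* s :* w) :* (x :* z)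
               :+ ((s :- q :* r :* w) :* (x :* y)
               :+ ((con 1ℤ :- q :* r :* s :* w) :* (x :* y :* z)
               :+ con 0ℤ)))))))
               := (x :+ q) :* (y :+ r) :* (z :+ s)
                  :- w :* ((q :* x :+ con 1ℤ) :* (r :* y :+ con 1ℤ) :* (s :* z :+ con 1ℤ)))
               refl ω (ω ^ Q) (ω ^ R) (ω ^ S) (x ^ Q) (x ^ R) (x ^ S) ⟩
        _ ≈⟨ +-cong (^n-+ x ω) (-‿cong (*-congˡ (b^n x))) ⟨
        c₂ x ∎
        where
        Q+S+R : ∀ Q R S → Q ℕ.+ S ℕ.+ R ≡ Q ℕ.+ R ℕ.+ S
        Q+S+R = solve-∀
        R+S+Q : ∀ Q R S → R ℕ.+ S ℕ.+ Q ≡ Q ℕ.+ R ℕ.+ S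
        R+S+Q = solve-∀
        Q+[R+S] : ∀ Q R S → Q ℕ.+ (R ℕ.+ S) ≡ Q ℕ.+ R ℕ.+ S
        Q+[R+S] = solve-∀
        R+[Q+S] : ∀ Q R S → R ℕ.+ (Q ℕ.+ S) ≡ Q ℕ.+ R ℕ.+ S
        R+[Q+S] = solve-∀
        S+[Q+R] : ∀ Q R S → S ℕ.+ (Q ℕ.+ R) ≡ Q ℕ.+ R ℕ.+ S
        S+[Q+R] = solve-∀

-- Finite Heyting fields

module FiniteHeytingField {c ℓ₁ ℓ₂} (F : HeytingField c ℓ₁ ℓ₂) where
  open OverField F
  open HeytingField F using (#⇒invertible; tight)
  open Polynomials F using (A; eval-cong)
  open CommutativeRing A renaming (zero to *-zero)
  open import Algebra.Apartness.Properties.HeytingCommutativeRing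
    (HeytingField.heytingCommutativeRing F) using (1#0; x-0≈x; invertibleʳ⇒#)

  inverseʳ : ∀ {x} (x#0 : Nonzero x) → x * inv x#0 ≈ 1#
  inverseʳ {x} x#0 = trans (*-congʳ (sym (x-0≈x x))) (proj₂ (proj₂ (#⇒invertible x#0)))

  -- Finiteness makes an inverse searchable. If none exists, x is not apart from 0, and tightness of
  -- the apartness relation gives x ≈ 0.
  finite⇒isDiscreteField : ∀ {n} → HasCardinality n → IsDiscreteField A
  finite⇒isDiscreteField enum = record { 1≉0 = λ 1≈0 → proj₂ (tight 1# 0#) 1≈0 1#0 ; inv? = inv? }
    where
    open FiniteSetoid setoid enum renaming (_≟_ to _≟F_)
    inv? : ∀ x → x ≈ 0# ⊎ ∃ λ y → x * y ≈ 1#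
    inv? x with Fin.any? (λ i → x * to i ≟F 1#)
    ... | yes (i , eq) = inj₂ (to i , eq)
    ... | no  ¬inv     = inj₁ (proj₁ (tight x 0#) λ x#0 →
      ¬inv (from (inv x#0) , trans (*-congˡ (to-from _)) (inverseʳ x#0)))

  invertible⇒nonzero : ∀ {x y} → x * y ≈ 1# → Nonzero x
  invertible⇒nonzero {x} {y} xy≈1 = invertibleʳ⇒# (y , trans (*-congʳ (x-0≈x x)) xy≈1)

  -- On a finite set injectivity implies surjectivity, and a nonzero constant factor does not affect
  -- it. This disposes of the division by `β`.
  permutes⇔ : ∀ {n} → HasCardinality n → ∀ f (h : Carrier → Carrier) {k} → ¬ (k ≈ 0#) →
    (∀ u → eval f u ≈ k * h u) → Permutes f ⇔ Injective _≈_ _≈_ h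
  permutes⇔ enum f h {k} k≉0 eval≈ = mk⇔ {B = Injective _≈_ _≈_ h}
    (λ (f-inj , _) {x} {y} hx≈hy → f-inj (trans (eval≈ x) (trans (*-congˡ hx≈hy) (sym (eval≈ y)))))
    (λ h-inj → bijective (f-injective h-inj))
    where
    open FiniteSetoid setoid enum
    open DiscreteField A (finite⇒isDiscreteField enum)
    f-injective : Injective _≈_ _≈_ h → Injective _≈_ _≈_ (eval f)
    f-injective h-inj {x} {y} eq = h-inj (*-cancelˡ k≉0 (trans (sym (eval≈ x)) (trans eq (eval≈ y))))
    bijective : Injective _≈_ _≈_ (eval f) → Permutes f
    bijective f-inj = f-inj , λ y →
      let i , fi≈y = injective⇒surjective f-inj y in to i , λ z≈ → trans (eval-cong f z≈) fi≈y

-- Coefficients of the normalised polynomials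

module Coefficients {c ℓ₁ ℓ₂} (F : HeytingField c ℓ₁ ℓ₂)
  (isDiscreteField : IsDiscreteField (Polynomials.A F))
  {ω} (isPrimitiveCubeRoot : IsPrimitiveCubeRoot (Polynomials.A F) ω)
  {Q R S} (Q-unit : Unit₃ Q) (R-unit : Unit₃ R) (S-unit : Unit₃ S) where

  open OverField F
  open Polynomials F
  open FiniteHeytingField F
  open CommutativeRing A renaming (zero to *-zero)
  open DiscreteField A isDiscreteField
  open CubeRoot A isDiscreteField ω isPrimitiveCubeRoot
  open IntegerCoefficients A
  open import Algebra.Properties.CommutativeSemiring.Exp commutativeSemiring
  open import Algebra.Properties.AbelianGroup +-abelianGroup using (x≈y⇒x∙y⁻¹≈ε)
  open import Relation.Binary.Reasoning.Setoid setoid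

  private
    n : ℕ
    n = Q ℕ.+ R ℕ.+ S

  difference : ℕ × ℕ → Carrier
  difference (u , v) = ω ^ u - ω ^ v

  -- `reciprocal` changes exponents only, so one list of differences serves `C₁` and `C₂`.
  C-coefficients : ∀ z → Pointwise (λ e t → proj₁ t ≈ difference e) (exponentPairs Q R S) (C ω Q R S z)
  C-coefficients 0F = +-congˡ (-‿cong (sym (*-identityʳ ω)))
    ∷ refl ∷ refl ∷ refl ∷ refl ∷ refl ∷ refl ∷ refl ∷ []
  C-coefficients 1F = +-congˡ (-‿cong (sym (*-identityʳ ω)))
    ∷ refl ∷ refl ∷ refl ∷ refl ∷ refl ∷ refl ∷ refl ∷ []

  -- For n ≡ 1 (mod 3) the leading coefficient ω^n - ω vanishes, which is why `β` is then taken from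
  -- the second term. Either choice is a nonzero difference with the exponent sum n + 1, to which
  -- every other coefficient can be compared.
  β-difference : ∃ λ (u , v) → u ℕ.+ v ≡ n ℕ.+ 1 × ¬ (u ≡₃ v) × β ω Q R S ≈ difference (u , v)
  β-difference = byCases (n % 3 ℕ.≟ 1)
    where
    branch : ∀ {b} → does (n % 3 ℕ.≟ 1) ≡ b →
      β ω Q R S ≈ (if b then ω ^ (Q ℕ.+ R) - ω ^ (S ℕ.+ 1) else ω ^ n - ω)
    branch eq = reflexive (≡.cong (λ b → if b then ω ^ (Q ℕ.+ R) - ω ^ (S ℕ.+ 1) else ω ^ n - ω) eq)
    byCases : Dec (n % 3 ≡ 1) →
      ∃ λ (u , v) → u ℕ.+ v ≡ n ℕ.+ 1 × ¬ (u ≡₃ v) × β ω Q R S ≈ difference (u , v)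
    byCases (yes n≡1) = (Q ℕ.+ R , S ℕ.+ 1) , ≡.sym (ℕ.+-assoc (Q ℕ.+ R) S 1) ,
      m+n≡₃1⇒m≢₃n+1 {Q ℕ.+ R} S-unit (mod₃ n≡1) , branch (dec-true (n % 3 ℕ.≟ 1) n≡1)
    byCases (no  n≢1) = (n , 1) , ≡.refl , (λ n≡₃1 → n≢1 (_≡₃_.residue n≡₃1)) ,
      trans (branch (dec-false (n % 3 ℕ.≟ 1) n≢1)) (+-congˡ (-‿cong (sym (*-identityʳ ω))))

  abstract
    -- Opaque, so that the type checker never unfolds this proof inside `inv β≠0`.
    β≠0 : Nonzero (β ω Q R S)
    β≠0 = let (u , v) , _ , u≢v , β≈ = β-difference in
      invertible⇒nonzero (proj₂ (inverse λ β≈0 →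
        ≉⇒-≉0 (λ eq → u≢v (ω^-injective eq)) (trans (sym β≈) β≈0)))

  inv*β≈1 : inv β≠0 * β ω Q R S ≈ 1#
  inv*β≈1 = trans (*-comm _ _) (inverseʳ β≠0)

  ratio-ternary : ∀ {i d u v u′ v′} → i * d ≈ 1# → d ≈ difference (u′ , v′) →
    ¬ (u′ ≡₃ v′) → u ℕ.+ v ≡ u′ ℕ.+ v′ → Ternary (i * difference (u , v))
  ratio-ternary {i} {d} {u} {v} {u′} {v′} id≈1 d≈ u′≢v′ sums with same-sum-mod-3 {u} {v} {u′} {v′} sums u′≢v′
  ... | inj₁ u≡v = inj₁ (trans (*-congˡ (x≈y⇒x∙y⁻¹≈ε (ω^-cong u≡v))) (zeroʳ _))
  ... | inj₂ (inj₁ (u≡u′ , v≡v′)) = inj₂ (inj₁ (begin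
    i * (ω ^ u - ω ^ v)         ≈⟨ *-congˡ (+-cong (ω^-cong u≡u′) (-‿cong (ω^-cong v≡v′))) ⟩
    i * (ω ^ u′ - ω ^ v′)       ≈⟨ *-congˡ d≈ ⟨
    i * d                       ≈⟨ id≈1 ⟩
    1#                          ∎))
  ... | inj₂ (inj₂ (u≡v′ , v≡u′)) = inj₂ (inj₂ (begin
    i * (ω ^ u - ω ^ v)         ≈⟨ *-congˡ (+-cong (ω^-cong u≡v′) (-‿cong (ω^-cong v≡u′))) ⟩
    i * (ω ^ v′ - ω ^ u′)       ≈⟨ solve 3 (λ i x y → i :* (y :- x) := :- (i :* (x :- y))) refl i (ω ^ u′) (ω ^ v′) ⟩
    - (i * (ω ^ u′ - ω ^ v′))   ≈⟨ -‿cong (*-congˡ d≈) ⟨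
    - (i * d)                   ≈⟨ -‿cong id≈1 ⟩
    - 1#                        ∎))

  difference-ternary : ∀ u v → u ℕ.+ v ≡ n ℕ.+ 1 → Ternary (inv β≠0 * difference (u , v))
  difference-ternary u v u+v≡ = let (u′ , v′) , u′+v′≡ , u′≢v′ , β≈ = β-difference in
    ratio-ternary {u = u} {v} {u′} {v′} inv*β≈1 β≈ u′≢v′ (≡.trans u+v≡ (≡.sym u′+v′≡))

  difference-vanishes : ∀ u v → nonvanishing (u , v) ≡ false → difference (u , v) ≈ 0#
  difference-vanishes u v eq with u % 3 ℕ.≟ v % 3
  ... | yes u≡v = x≈y⇒x∙y⁻¹≈ε (ω^-cong {u} {v} (mod₃ u≡v))
  ... | no  u≢v with () ← ≡.trans (≡.sym eq) (≡.cong not (dec-false (u % 3 ℕ.≟ v % 3) u≢v))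

  scale-ternary : ∀ {es f} → All (λ (u , v) → u ℕ.+ v ≡ n ℕ.+ 1) es →
    Pointwise (λ e t → proj₁ t ≈ difference e) es f → TernaryCoeffs (scale (inv β≠0) f)
  scale-ternary {[]}           []           []       = []
  scale-ternary {(u , v) ∷ es} (sum ∷ sums) (a≈ ∷ f) =
    Ternary-cong (*-congˡ a≈) (difference-ternary u v sum) ∷ scale-ternary sums f

  scale-zeroUnless : ∀ {es f} k → Pointwise (λ e t → proj₁ t ≈ difference e) es f →
    Pointwise ZeroUnless (map nonvanishing es) (scale k f)
  scale-zeroUnless {[]}           k []       = []
  scale-zeroUnless {(u , v) ∷ es} k (a≈ ∷ f) =
    (λ eq → trans (*-congˡ (trans a≈ (difference-vanishes u v eq))) (zeroʳ k)) ∷ scale-zeroUnless k f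

  B-ternary : ∀ z → TernaryCoeffs (B ω Q R S β≠0 z)
  B-ternary z = scale-ternary (exponentPairs-sum Q R S) (C-coefficients z)

  B-atMostTerms : ∀ z → AtMostTerms 5 (B ω Q R S β≠0 z)
  B-atMostTerms z = ≡.subst (λ m → AtMostTerms m (B ω Q R S β≠0 z))
    (count-nonvanishing Q-unit R-unit S-unit)
    (atMostTerms (scale-zeroUnless (inv β≠0) (C-coefficients z)))

  B-unique : Unique (map proj₁ (exponentPairs Q R S)) → ∀ z → Unique (map proj₂ (B ω Q R S β≠0 z))
  B-unique u 0F = u
  B-unique u 1F = Unique-∸ (exponentPairs-≤ Q R S) u

-- The theorem takes a gcd of integers because of the sign of e. On nonnegative integers it computes
-- to the image of a natural gcd, here `n`, while `m` is its form in the criterion.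
through-ℤ : ∀ {a b} {X : Set a} {Y : Set b} {G : Set} {m n} → m ≡ n →
  X ⇔ Y → Y ⇔ (G × m ≡ 1) → X ⇔ (G × + n ≡ 1ℤ)
through-ℤ ≡.refl X⇔Y Y⇔ = mk⇔
  (λ x → map₂ (≡.cong +_) (Equivalence.to Y⇔ (Equivalence.to X⇔Y x)))
  (λ y → Equivalence.from X⇔Y (Equivalence.from Y⇔ (map₂ ℤ.+-injective y)))

-- Specialisation to the given field and exponents

module Theorem {c ℓ₁ ℓ₂} (p k q-1 : ℕ) (p-prime : Prime p) (p≢3 : p ≢ 3)
  (0<k : 0 ℕ.< k) (q≡p^k : suc q-1 ≡ p ℕ.^ k)
  (F : HeytingField c ℓ₁ ℓ₂)
  (card : OverField.HasCardinality F (suc q-1 ℕ.^ 2))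
  (Q R S : ℕ) (Q-power : IsPowerOf p Q) (R-power : IsPowerOf p R) (S-power : IsPowerOf p S)
  (ω : HeytingField.Carrier F) (ω-order : OverField.HasOrder F ω 3)
  (r : ℕ) (0<r : 0 ℕ.< r) (r≡n : r % suc (suc q-1) ≡ (Q ℕ.+ R ℕ.+ S) % suc (suc q-1))
  where

  open OverField F
  open Polynomials F
  open FiniteHeytingField F
  open CommutativeRing A renaming (zero to *-zero)
  open import Algebra.Properties.CommutativeSemiring.Exp commutativeSemiring
  open import Algebra.Properties.Semiring.Mult semiring using (×1-homo-*) renaming (_×_ to _·_)
  open import Relation.Binary.Reasoning.Setoid setoid

  q n : ℕ
  q = suc q-1
  n = Q ℕ.+ R ℕ.+ S

  q²≡ : q ℕ.^ 2 ≡ suc (q-1 ℕ.* suc (suc q-1))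
  q²≡ = lemma q-1
    where
    lemma : ∀ m → suc m ℕ.* (suc m ℕ.* 1) ≡ suc (m ℕ.* suc (suc m))
    lemma = solve-∀

  enum : HasCardinality (suc (q-1 ℕ.* suc (suc q-1)))
  enum = ≡.subst HasCardinality q²≡ card

  isField : IsDiscreteField A
  isField = finite⇒isDiscreteField enum

  open DiscreteField A isField
  open FiniteField A isField enum using (cardinality·1≈0)

  p^·1 : ∀ i → (p ℕ.^ i) · 1# ≈ (p · 1#) ^ i
  p^·1 zero    = +-identityʳ 1#
  p^·1 (suc i) = trans (×1-homo-* p (p ℕ.^ i)) (*-congˡ (p^·1 i))

  -- (p · 1)^(2k) is the cardinality q² times 1, hence 0, and a field has no nonzero nilpotent
  -- elements.
  p·1≈0 : p · 1# ≈ 0#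
  p·1≈0 = ^≈0⇒≈0 (k ℕ.* 2) (begin
    (p · 1#) ^ (k ℕ.* 2)                  ≈⟨ p^·1 (k ℕ.* 2) ⟨
    (p ℕ.^ (k ℕ.* 2)) · 1#                ≡⟨ ≡.cong (_· 1#) (ℕ.^-*-assoc p k 2) ⟨
    ((p ℕ.^ k) ℕ.^ 2) · 1#                ≡⟨ ≡.cong (λ m → (m ℕ.^ 2) · 1#) q≡p^k ⟨
    (q ℕ.^ 2) · 1#                        ≡⟨ ≡.cong (_· 1#) q²≡ ⟩
    suc (q-1 ℕ.* suc (suc q-1)) · 1#      ≈⟨ cardinality·1≈0 ⟩
    0#                                    ∎)

  power-additive : ∀ {m} → IsPowerOf p m → Powers.AdditiveExponent A m
  power-additive (i , ≡.refl) = Frobenius.^p^i-distrib-+ A p-prime p·1≈0 i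

  power-positive : ∀ {m} → IsPowerOf p m → 0 ℕ.< m
  power-positive (i , ≡.refl) = ℕ.m^n>0 p {{prime⇒nonZero p-prime}} i

  power-unit : ∀ {m} → IsPowerOf p m → Unit₃ m
  power-unit (i , ≡.refl) = Unit₃-^ i (prime-Unit₃ p-prime p≢3)

  0<n : 0 ℕ.< n
  0<n = ℕ.≤-trans (power-positive S-power) (ℕ.m≤n+m S (Q ℕ.+ R))

  0<q-1 : 0 ℕ.< q-1
  0<q-1 = ℕ.s<s⁻¹ (≡.subst (1 ℕ.<_) (≡.sym q≡p^k) (ℕ.<-≤-trans (ℕ.nonTrivial⇒n>1 p {{prime⇒nonTrivial p-prime}}) p≤p^k))
    where
    p≤p^k : p ℕ.≤ p ℕ.^ k
    p≤p^k = ≡.subst (ℕ._≤ p ℕ.^ k) (ℕ.*-identityʳ p) (ℕ.^-monoʳ-≤ p {{prime⇒nonZero p-prime}} 0<k)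

  isCubeRoot : IsPrimitiveCubeRoot A ω
  isCubeRoot = record
    { ω³≈1 = trans (*-assoc ω ω ω) (trans (*-congˡ (*-congˡ (sym (*-identityʳ ω)))) (proj₁ (proj₂ ω-order)))
    ; ω≉1  = λ ω≈1 → ℕ.<⇒≱ (s<s {n = 2} (s≤s z≤n))
        (proj₂ (proj₂ ω-order) 1 (s≤s z≤n) (trans (*-identityʳ ω) ω≈1))
    }

  open CubeRoot A isField ω isCubeRoot
  open Coefficients F isField isCubeRoot (power-unit Q-power) (power-unit R-power) (power-unit S-power) public
  open EvaluateC ω Q R S (power-additive Q-power) (power-additive R-power) (power-additive S-power)
  open RedeiPermutations A isField q-1 0<q-1 enum (power-additive (k , q≡p^k)) ω isCubeRoot n 0<n
    using (module SplitCase; module InertCase)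

  part₁ : ∀ z → AtMostTerms 5 (B ω Q R S β≠0 z)
    × CoeffsInPrimeField (B ω Q R S β≠0 z)
    × (Q ≢ R → Q ≢ S → R ≢ S → TermsHaveCoeff±1 (B ω Q R S β≠0 z))
  part₁ z = B-atMostTerms z , coeffsInPrimeField (q-1 ℕ.* suc (suc q-1)) cardinality·1≈0 (B-ternary z) , λ Q≢R Q≢S R≢S →
    termsHaveCoeff±1 (B-ternary z) (B-unique (distinct-exponents
      (power-positive Q-power) (power-positive R-power) (power-positive S-power) Q≢R Q≢S R≢S
      (powers-sum-≢ p-prime Q-power R-power S-power Q≢R)
      (powers-sum-≢ p-prime Q-power S-power R-power Q≢S)
      (powers-sum-≢ p-prime R-power S-power Q-power R≢S)) z)

  f : Fin 2 → Poly
  f z = shift r (expand q-1 (B ω Q R S β≠0 z))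

  inv≉0 : ¬ (inv β≠0 ≈ 0#)
  inv≉0 inv≈0 = IsDiscreteField.1≉0 isField (trans (sym inv*β≈1) (trans (*-congʳ inv≈0) (zeroˡ _)))

  eval-f : ∀ z (c : Carrier → Carrier) → (∀ x → eval (C ω Q R S z) x ≈ c x) → ∀ u → eval (f z) u ≈ inv β≠0 * (u ^ r * c (u ^ q-1))
  eval-f z c eval-C u = begin
    eval (f z) u                                          ≈⟨ eval-shift r (expand q-1 (B ω Q R S β≠0 z)) u ⟩
    u ^ r * eval (expand q-1 (B ω Q R S β≠0 z)) u         ≈⟨ *-congˡ (eval-expand q-1 (B ω Q R S β≠0 z) u) ⟩
    u ^ r * eval (B ω Q R S β≠0 z) (u ^ q-1)              ≈⟨ *-congˡ (eval-scale (inv β≠0) (C ω Q R S z) (u ^ q-1)) ⟩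
    u ^ r * (inv β≠0 * eval (C ω Q R S z) (u ^ q-1))      ≈⟨ *-congˡ (*-congˡ (eval-C (u ^ q-1))) ⟩
    u ^ r * (inv β≠0 * c (u ^ q-1))                       ≈⟨ x∙yz≈y∙xz (u ^ r) (inv β≠0) (c (u ^ q-1)) ⟩
    inv β≠0 * (u ^ r * c (u ^ q-1))                       ∎
    where open import Algebra.Properties.CommutativeSemigroup *-commutativeSemigroup using (x∙yz≈y∙xz)

  -- Integer divisibility computes to divisibility of the absolute value, here q - 1, so the
  -- hypothesis provides the multiple of 3 that is removed from the exponent.
  ω^q : ∀ {e} → e ≡ 1ℤ → (+ 3) ℤ.∣ (+ q ℤ.- e) → ω ^ q ≈ ω
  ω^q ≡.refl (divides t q-1≡3t) = begin
    ω ^ (1 ℕ.+ q-1)       ≡⟨ ≡.cong (λ m → ω ^ (1 ℕ.+ m)) q-1≡3t ⟩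
    ω ^ (1 ℕ.+ t ℕ.* 3)   ≈⟨ Powers.^-+* A 3 1 t ω^3≈1 ⟩
    ω ^ 1                 ≈⟨ *-identityʳ ω ⟩
    ω                     ∎

  ω^q′ : ∀ {e} → e ≡ -1ℤ → (+ 3) ℤ.∣ (+ q ℤ.- e) → ω ^ q ≈ ω * ω
  ω^q′ ≡.refl (divides t q+1≡3t) = *-cancelʳ ω≉0 (begin
    ω ^ q * ω             ≈⟨ *-congˡ (*-identityʳ ω) ⟨
    ω ^ q * ω ^ 1         ≈⟨ ^-homo-* ω q 1 ⟨
    ω ^ (q ℕ.+ 1)         ≡⟨ ≡.cong (ω ^_) q+1≡3t ⟩
    ω ^ (t ℕ.* 3)         ≈⟨ Powers.^-*≈1 A 3 t ω^3≈1 ⟩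
    1#                    ≈⟨ IsPrimitiveCubeRoot.ω³≈1 isCubeRoot ⟨
    ω * ω * ω             ∎)

  permutes-f⇔ : ∀ z (c : Carrier → Carrier) → (∀ x → eval (C ω Q R S z) x ≈ c x) →
    Permutes (f z) ⇔ Injective _≈_ _≈_ (λ u → u ^ r * c (u ^ q-1))
  permutes-f⇔ z c eval-C = permutes⇔ enum (f z) (λ u → u ^ r * c (u ^ q-1)) inv≉0 (eval-f z c eval-C)

  open RedeiForms A ω n using (c₁; c₂)

  part₂ : ∀ z e → e ≡ 1ℤ ⊎ e ≡ -1ℤ → (+ 3) ℤ.∣ (+ q ℤ.- e) →
    Permutes (f z) ⇔ (gcd r q-1 ≡ 1 × ℤ.gcd (+ n) (+ q ℤ.+ e) ≡ 1ℤ)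
  part₂ 0F _ (inj₁ ≡.refl) 3∣ = through-ℤ (≡.cong (gcd n) (ℕ.+-comm 1 q))
    (permutes-f⇔ 0F c₁ eval-C₁) (SplitCase.c₁-criterion (ω^q ≡.refl 3∣) 0<r r≡n)
  part₂ 1F _ (inj₁ ≡.refl) 3∣ = through-ℤ (≡.cong (gcd n) (ℕ.+-comm 1 q))
    (permutes-f⇔ 1F c₂ eval-C₂) (SplitCase.c₂-criterion (ω^q ≡.refl 3∣) 0<r r≡n)
  part₂ 0F _ (inj₂ ≡.refl) 3∣ = through-ℤ ≡.refl
    (permutes-f⇔ 0F c₁ eval-C₁) (InertCase.c₁-criterion (ω^q′ ≡.refl 3∣) 0<r r≡n)
  part₂ 1F _ (inj₂ ≡.refl) 3∣ = through-ℤ ≡.refl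
    (permutes-f⇔ 1F c₂ eval-C₂) (InertCase.c₂-criterion (ω^q′ ≡.refl 3∣) 0<r r≡n)

open import Data.Nat.Base using (_+_; _^_; _<_)

theorem1p1 : ∀ {c ℓ₁ ℓ₂} (p k q : ℕ) → Prime p → p ≢ 3 → 0 < k → q ≡ p ^ k →
    (F : HeytingField c ℓ₁ ℓ₂) →
    let open OverField F in
    HasCardinality (q ^ 2) →
    (Q R S : ℕ) → IsPowerOf p Q → IsPowerOf p R → IsPowerOf p S →
    (ω : HeytingField.Carrier F) → HasOrder ω 3 →
    (r : ℕ) → 0 < r → r % suc q ≡ (Q + R + S) % suc q →
    Σ (Nonzero (β ω Q R S)) λ β≠0 →
    (z : Fin 2) →
    let Bz = B ω Q R S β≠0 z in
    (AtMostTerms 5 Bz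
    × CoeffsInPrimeField Bz
    × (Q ≢ R → Q ≢ S → R ≢ S → TermsHaveCoeff±1 Bz))
    × ((e : ℤ) → (e ≡ 1ℤ ⊎ e ≡ -1ℤ) → (+ 3) ℤ.∣ (+ q ℤ.- e) →
    Permutes (shift r (expand (q ∸ 1) Bz))
    ⇔ (gcd r (q ∸ 1) ≡ 1 × ℤ.gcd (+ (Q + R + S)) (+ q ℤ.+ e) ≡ 1ℤ))
-- q = 0 is excluded because `p ^ k` is positive; with q in the form `suc q-1` the `q ∸ 1` of the
-- statement computes.
theorem1p1 p k zero p-prime p≢3 0<k 0≡p^k =
  contradiction 0≡p^k (ℕ.<⇒≢ (ℕ.m^n>0 p {{prime⇒nonZero p-prime}} k))
theorem1p1 p k (suc q-1) p-prime p≢3 0<k q≡p^k F card Q R S Q-power R-power S-power ω ω-order r 0<r r≡n =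
  β≠0 , λ z → part₁ z , part₂ z
  where
  open Theorem p k q-1 p-prime p≢3 0<k q≡p^k F card Q R S Q-power R-power S-power ω ω-order r 0<r r≡n
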